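{- Let $V_n(x_1,\dots,x_n)$ denote the volume polynomial. Then: (i) for all $n\ge 1$ and $a,b\ge 0$, $$n!\,V_n(a,b,\dots,b)=a(a+nb)^{n-1};$$ (ii) for all $n\ge 3$ and $a,b,c\ge 0$, $$n!\,V_n(a,\underbrace{b,\dots,b}_{n-2\text{ places}},c)=a(a+nb)^{n-1}+na(c-b)(a+(n-1)b)^{n-2};$$ (iii) for all $n\ge 3$, $1\le m\le n-2$ and $a,b,c\ge 0$, $$n!\,V_n(a,\underbrace{b,\dots,b}_{n-m-1\text{ places}},c,\underbrace{0,\dots,0}_{m-1\text{ places}})=a\sum_{j=0}^m\binom{n}{j}\big(c-(m+1-j)b\big)^j\big(a+(n-j)b\big)^{n-j-1}.$$
   Context: For $x\in\mathbb{R}^n$ with all $x_i>0$, $V_n(x)$ is the $n$-dimensional volume of $\Pi_n(x)=\{y\in\mathbb{R}^n: y_i\ge 0 \text{ and } y_1+\cdots+y_i\le x_1+\cdots+x_i \text{ for all } 1\le i\le n\}$. It is given by a homogeneous polynomial of degree $n$ in $x_1,\dots,x_n$, called the volume polynomial, and $V_n$ is evaluated as this polynomial at arbitrary arguments (for nonnegative arguments it still equals the volume of $\Pi_n(x)$). Convention: $0^0=1$. -}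

module Defs where

open import Algebra.Apartness.Bundles using (HeytingField)
open import Algebra.Bundles using (CommutativeRing; Semiring)
import Algebra.Definitions.RawSemiring as RawSemiringDefs
open import Data.Integer as ℤ using (ℤ; +_; -[1+_])
open import Data.List as List using (List; length)
import Data.List.Relation.Unary.All as ListAll
open import Data.List.Membership.Propositional using (_∈_)
open import Data.List.Relation.Unary.Unique.Propositional using (Unique)
open import Data.Nat as ℕ using (ℕ)
open import Data.Product using (_×_; _,_; ∃-syntax; proj₂)
open import Data.Sum using (_⊎_)
open import Data.Vec as Vec using (Vec; truncate; zipWith)
open import Data.Vec.Relation.Binary.Pointwise.Inductive using (Pointwise)
open import Data.Vec.Relation.Unary.All using (All)
open import Level using (Level; _⊔_; suc)
open import Relation.Binary using (Rel; IsStrictPartialOrder; _Preserves_⟶_)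
open import Relation.Binary.PropositionalEquality using (_≡_)
open import Relation.Nullary using (¬_)
open import Relation.Unary using (Pred)

-- The real numbers, axiomatised as a Cauchy-complete Archimedean ordered
-- field.  Classically there is exactly one such field up to isomorphism; the
-- axioms are in constructive form: "nonzero" is apartness and `x ≤ y` is
-- `¬ y < x`.
record RealNumbers (c ℓ₁ ℓ₂ ℓ₃ : Level) : Set (suc (c ⊔ ℓ₁ ⊔ ℓ₂ ⊔ ℓ₃)) where
  infix 4 _<_ _≤_ _ConvergesTo_
  field
    heytingField : HeytingField c ℓ₁ ℓ₂

  open HeytingField heytingField public

  commutativeRing : CommutativeRing c ℓ₁
  commutativeRing = record { isCommutativeRing = isCommutativeRing }

  open CommutativeRing commutativeRing public using (semiring)
  open RawSemiringDefs (Semiring.rawSemiring semiring) public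
    using (_^_; sum) renaming (_×_ to infixr 8 _·_)

  field
    _<_                  : Rel Carrier ℓ₃
    isStrictPartialOrder : IsStrictPartialOrder _≈_ _<_
    <⇒#                  : ∀ {x y} → x < y → x # y
    #⇒<∨>                : ∀ {x y} → x # y → (x < y) ⊎ (y < x)
    0<1                  : 0# < 1#
    +-monoˡ-<            : ∀ z → (_+ z) Preserves _<_ ⟶ _<_
    *-pos                : ∀ {x y} → 0# < x → 0# < y → 0# < x * y
    archimedean          : ∀ x → ∃[ n ] x < n · 1#

  _≤_ : Rel Carrier ℓ₃
  x ≤ y = ¬ (y < x)

  IsCauchy : (ℕ → Carrier) → Set (c ⊔ ℓ₃)
  IsCauchy s = ∀ ε → 0# < ε →
    ∃[ N ] (∀ m n → N ℕ.≤ m → N ℕ.≤ n → s m - s n < ε)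

  _ConvergesTo_ : (ℕ → Carrier) → Carrier → Set (c ⊔ ℓ₃)
  s ConvergesTo l = ∀ ε → 0# < ε →
    ∃[ N ] (∀ n → N ℕ.≤ n → (s n - l < ε) × (l - s n < ε))

  field
    complete : ∀ s → IsCauchy s → ∃[ l ] (s ConvergesTo l)

  fromℤ : ℤ → Carrier
  fromℤ (+ n)    = n · 1#
  fromℤ -[1+ n ] = - (ℕ.suc n · 1#)

module Volume {c ℓ₁ ℓ₂ ℓ₃} (ℝ : RealNumbers c ℓ₁ ℓ₂ ℓ₃) where

  open RealNumbers ℝ

  Point : ℕ → Set c
  Point n = Vec Carrier n

  -- The closed grid cube ∏ᵢ [kᵢ / N , (kᵢ + 1) / N], for N ≥ 1.
  Cube : ∀ {n} → ℕ → Vec ℤ n → Pred (Point n) (c ⊔ ℓ₃)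
  Cube N k y = Pointwise
    (λ kᵢ yᵢ → (fromℤ kᵢ ≤ N · yᵢ) × (N · yᵢ ≤ fromℤ (ℤ.suc kᵢ))) k y

  -- n-dimensional volume, as Jordan content: both the total volume of the
  -- cubes of the grid of mesh 1/N lying inside S and the total volume of those
  -- meeting S tend to v as N → ∞.  Constructively these cubes cannot in
  -- general be counted exactly, so `inner` lists some of the former and
  -- `outer` at least all of the latter; v is still unique.  Volumes are
  -- multiplied through by Nⁿ, each cube having volume 1/Nⁿ.
  HasVolume : ∀ {n ℓ} → Pred (Point n) ℓ → Carrier → Set (c ⊔ ℓ₃ ⊔ ℓ)
  HasVolume {n} S v = ∀ ε → 0# < ε → ∃[ N₀ ] (∀ N → N₀ ℕ.≤ N → 1 ℕ.≤ N →
    ∃[ inner ] ∃[ outer ]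
      Unique inner
    × (∀ k → k ∈ inner → ∀ y → Cube N k y → S y)
    × (∀ k y → Cube N k y → S y → k ∈ outer)
    × ((N ℕ.^ n) · (v - ε) < length {A = Vec ℤ n} inner · 1#)
    × (length {A = Vec ℤ n} outer · 1# < (N ℕ.^ n) · (v + ε)))

  total : ∀ {n} → Point n → Carrier
  total = Vec.foldr′ _+_ 0#

  Π : ∀ {n} → Point n → Pred (Point n) (c ⊔ ℓ₃)
  Π {n} x y = All (0# ≤_) y
    × (∀ {i} (i≤n : i ℕ.≤ n) → 1 ℕ.≤ i →
        total (truncate i≤n y) ≤ total (truncate i≤n x))

  -- A polynomial in n variables: a formal sum of monomials, each given by its
  -- coefficient and its exponents.
  Polynomial : ℕ → Set c
  Polynomial n = List (Carrier × Vec ℕ n)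

  evalMonomial : ∀ {n} → Carrier × Vec ℕ n → Point n → Carrier
  evalMonomial (a , e) x = a * Vec.foldr′ _*_ 1# (zipWith _^_ x e)

  eval : ∀ {n} → Polynomial n → Point n → Carrier
  eval p x = List.foldr _+_ 0# (List.map (λ m → evalMonomial m x) p)

  Homogeneous : ∀ {n} → ℕ → Polynomial n → Set c
  Homogeneous d p = ListAll.All (λ m → Vec.sum (proj₂ m) ≡ d) p

  record IsVolumePolynomial {n} (p : Polynomial n) : Set (c ⊔ ℓ₃) where
    field
      homogeneous : Homogeneous n p
      volume      : ∀ x → All (0# <_) x → HasVolume (Π x) (eval p x)

-- V_n is the iterated integral V_n(a, x₂, …) = ∫₀ᵃ V_{n-1}(t + x₂, x₃, …) dt.  At points with
-- positive integer coordinates this is seen by counting the lattice points k of the dilate N Π_n: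
-- the count satisfies the analogous recursion with a sum in place of the integral, and since the
-- iterated integrals have nonnegative coefficients, mean value inequalities put it between
-- Nⁿ V_n(x) and Nⁿ V_n(x) + O(Nⁿ⁻¹).  Two polynomials that agree at positive integers agree
-- everywhere.  Finally, n! V_n is determined by ∂(n! V_n)/∂a = n · (n-1)! V_{n-1}(a + x₂, x₃, …)
-- and its vanishing at a = 0; the right-hand sides have these two properties because the Abel
-- polynomials A_k(a) = a (a + k b)^{k-1} satisfy A_k′(a) = k A_{k-1}(a + b), and the induction
-- starts with Abel's binomial theorem, which follows in the same way.  Part (ii) is the case m = 1
-- of (iii).
module Submission where

open import Defs
open import Algebra.Apartness.Bundles using (HeytingField)
open import Algebra.Bundles using (CommutativeRing)
open import Data.Empty using (⊥)
open import Data.Fin as Fin using (Fin; toℕ)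
open import Data.Fin.Properties using (toℕ<n)
open import Data.List as List using (List; []; _∷_; _++_; length; map; replicate)
open import Data.List.Membership.Propositional using (_∈_)
open import Data.List.Membership.Propositional.Properties
  using (∈-map⁺; ∈-map⁻; ∈-++⁺ˡ; ∈-++⁺ʳ; ∈-++⁻; ∈-∃++)
open import Data.List.Properties using (length-++; length-map)
import Data.List.Relation.Binary.Pointwise as ListPointwise
open import Data.List.Relation.Unary.All as All using (All; []; _∷_)
open import Data.List.Relation.Unary.AllPairs using ([]; _∷_)
open import Data.List.Relation.Unary.Any using (here; there)
open import Data.List.Relation.Unary.Unique.Propositional using (Unique)
import Data.List.Relation.Unary.Unique.Propositional.Properties as Unique
open import Data.Nat as ℕ using (ℕ; zero; suc; _∸_; _!; z≤n; s≤s)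
open import Data.Nat.Combinatorics
  using (_C_; k![n∸k]!∣n!; k>n⇒nCk≡0; nCn≡1; nC1≡n; nCk≡nC[n∸k]; nCk≡n!/k![n-k]!)
open import Data.Nat.DivMod using (m/n*n≡m)
import Data.Nat.Properties as ℕ
open import Data.Product using (_×_; _,_; ∃-syntax; proj₁; proj₂)
open import Data.Sum using (_⊎_; inj₁; inj₂)
open import Data.Vec as Vec using (Vec; []; _∷_; toList; truncate)
import Data.Vec.Properties as Vec
open import Data.Vec.Relation.Binary.Pointwise.Inductive using ([]; _∷_)
open import Data.Vec.Relation.Unary.All as VecAll using ([]; _∷_)
open import Function using (_∘_)
open import Level using (_⊔_)
open import Relation.Binary using (IsStrictPartialOrder; IsPreorder)
open import Relation.Binary.PropositionalEquality as ≡ using (_≡_)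
open import Relation.Nullary using (¬_; yes; no; contradiction)

-- Integer points are chosen because there all bounds of the dilate N Π are integers, and one finite
-- set serves both halves of the definition of volume: the k whose prefix sums lie strictly below
-- the bounds. If the cube at k lies inside Π, its upper corner exceeds k by i in the i-th prefix
-- sum, which forces strictness; conversely, strictness puts the lower corner into Π, so that the
-- cube meets Π. Hence every admissible `inner` is at most as long as this one list, and every
-- admissible `outer` at least as long. The order on the reals is not decidable, so equality of the
-- volume with `W` is reached by refuting both strict inequalities. The error term arises because
-- each coordinate replaces an integral by a sum over unit steps and thereby costs a shift of the
-- first argument by one. Calculus is formal throughout: differentiation acts on coefficient lists,
-- and a polynomial is recovered from its derivative by the identity principle and cancellation of
-- positive integers.

-- Order and arithmetic of the real numbers, constructively.

module OrderedField {c ℓ₁ ℓ₂ ℓ₃} (ℝ : RealNumbers c ℓ₁ ℓ₂ ℓ₃) where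
  open RealNumbers ℝ
  open CommutativeRing commutativeRing using (commutativeSemiring)
  open IsStrictPartialOrder isStrictPartialOrder public
    using (<-resp-≈; <-respˡ-≈; <-respʳ-≈)
    renaming (irrefl to <-irrefl; trans to <-trans; asym to <-asym)
  open import Algebra.Apartness.Properties.HeytingCommutativeRing
    (HeytingField.heytingCommutativeRing heytingField)
    using (invertibleˡ⇒#; x-0≈x)
  open import Algebra.Properties.Semiring.Mult semiring hiding (_×_)
  open import Algebra.Solver.Ring.NaturalCoefficients.Default commutativeSemiring
    using (solve; _:=_; _:*_)
  open import Relation.Binary.Reasoning.Setoid setoid

  [x-y]+y≈x : ∀ x y → (x - y) + y ≈ x
  [x-y]+y≈x x y = begin
    (x + - y) + y ≈⟨ +-assoc x (- y) y ⟩
    x + (- y + y) ≈⟨ +-congˡ (-‿inverseˡ y) ⟩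
    x + 0#        ≈⟨ +-identityʳ x ⟩
    x             ∎

  -- Substitute for trichotomy: apartness is cotransitive, each outcome is split by `#⇒<∨>`, and the
  -- unwanted direction is absorbed by transitivity. The mixed transitivity laws of `<` and `≤` rest
  -- on it.
  <-cotrans : ∀ {x y} → x < y → ∀ z → x < z ⊎ z < y
  <-cotrans x<y z with #-cotrans (<⇒# x<y) z
  ... | inj₁ x#z with #⇒<∨> x#z
  ...   | inj₁ x<z = inj₁ x<z
  ...   | inj₂ z<x = inj₂ (<-trans z<x x<y)
  <-cotrans x<y z | inj₂ z#y with #⇒<∨> z#y
  ...   | inj₁ z<y = inj₂ z<y
  ...   | inj₂ y<z = inj₁ (<-trans x<y y<z)

  <⇒≤ : ∀ {x y} → x < y → x ≤ y
  <⇒≤ = <-asym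

  ≤-reflexive : ∀ {x y} → x ≈ y → x ≤ y
  ≤-reflexive x≈y = <-irrefl (sym x≈y)

  ≤-refl : ∀ {x} → x ≤ x
  ≤-refl = ≤-reflexive refl

  <-≤-trans : ∀ {x y z} → x < y → y ≤ z → x < z
  <-≤-trans {z = z} x<y y≤z with <-cotrans x<y z
  ... | inj₁ x<z = x<z
  ... | inj₂ z<y = contradiction z<y y≤z

  ≤-<-trans : ∀ {x y z} → x ≤ y → y < z → x < z
  ≤-<-trans {x} x≤y y<z with <-cotrans y<z x
  ... | inj₁ y<x = contradiction y<x x≤y
  ... | inj₂ x<z = x<z

  ≤-trans : ∀ {x y z} → x ≤ y → y ≤ z → x ≤ z
  ≤-trans x≤y y≤z z<x = y≤z (<-≤-trans z<x x≤y)

  ≤-antisym : ∀ {x y} → x ≤ y → y ≤ x → x ≈ y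
  ≤-antisym {x} {y} x≤y y≤x = proj₁ (tight x y) x¬#y
    where
    x¬#y : ¬ (x # y)
    x¬#y x#y with #⇒<∨> x#y
    ... | inj₁ x<y = y≤x x<y
    ... | inj₂ y<x = x≤y y<x

  ≤-isPreorder : IsPreorder _≈_ _≤_
  ≤-isPreorder = record
    { isEquivalence = isEquivalence ; reflexive = ≤-reflexive ; trans = ≤-trans }

  module ≤-Reasoning where
    open import Relation.Binary.Reasoning.Base.Triple
      ≤-isPreorder <-asym <-trans <-resp-≈ <⇒≤ <-≤-trans ≤-<-trans public

  +-monoʳ-< : ∀ z {x y} → x < y → z + x < z + y
  +-monoʳ-< z x<y = <-respˡ-≈ (+-comm _ z) (<-respʳ-≈ (+-comm _ z) (+-monoˡ-< z x<y))

  +-cancelˡ-< : ∀ z {x y} → z + x < z + y → x < y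
  +-cancelˡ-< z {x} {y} z+x<z+y =
    <-respˡ-≈ (cancel x) (<-respʳ-≈ (cancel y) (+-monoʳ-< (- z) z+x<z+y))
    where
    cancel : ∀ x → - z + (z + x) ≈ x
    cancel x = begin
      - z + (z + x) ≈⟨ +-assoc (- z) z x ⟨
      - z + z + x   ≈⟨ +-congʳ (-‿inverseˡ z) ⟩
      0# + x        ≈⟨ +-identityˡ x ⟩
      x             ∎

  +-monoʳ-≤ : ∀ z {x y} → x ≤ y → z + x ≤ z + y
  +-monoʳ-≤ z x≤y = x≤y ∘ +-cancelˡ-< z

  +-monoˡ-≤ : ∀ z {x y} → x ≤ y → x + z ≤ y + z
  +-monoˡ-≤ z x≤y = ≤-trans (≤-reflexive (+-comm _ z))
    (≤-trans (+-monoʳ-≤ z x≤y) (≤-reflexive (+-comm z _)))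

  +-mono-≤ : ∀ {x y u v} → x ≤ y → u ≤ v → x + u ≤ y + v
  +-mono-≤ {y = y} {u} x≤y u≤v = ≤-trans (+-monoˡ-≤ u x≤y) (+-monoʳ-≤ y u≤v)

  +-nonneg : ∀ {x y} → 0# ≤ x → 0# ≤ y → 0# ≤ x + y
  +-nonneg 0≤x 0≤y = ≤-trans (≤-reflexive (sym (+-identityˡ 0#))) (+-mono-≤ 0≤x 0≤y)

  x≤x+y : ∀ {x y} → 0# ≤ y → x ≤ x + y
  x≤x+y {x} 0≤y = ≤-trans (≤-reflexive (sym (+-identityʳ x))) (+-monoʳ-≤ x 0≤y)

  x<y⇒0<y-x : ∀ {x y} → x < y → 0# < y - x
  x<y⇒0<y-x {x} x<y = <-respˡ-≈ (-‿inverseʳ x) (+-monoˡ-< (- x) x<y)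

  x≤y⇒0≤y-x : ∀ {x y} → x ≤ y → 0# ≤ y - x
  x≤y⇒0≤y-x {x} x≤y = ≤-trans (≤-reflexive (sym (-‿inverseʳ x))) (+-monoˡ-≤ (- x) x≤y)

  *-distribˡ-[y-x]+x : ∀ z x y → z * (y - x) + z * x ≈ z * y
  *-distribˡ-[y-x]+x z x y = trans (sym (distribˡ z (y - x) x)) (*-congˡ ([x-y]+y≈x y x))

  *-monoˡ-< : ∀ {z x y} → 0# < z → x < y → z * x < z * y
  *-monoˡ-< {z} {x} {y} 0<z x<y =
    <-respˡ-≈ (+-identityˡ (z * x))
      (<-respʳ-≈ (*-distribˡ-[y-x]+x z x y)
        (+-monoˡ-< (z * x) (*-pos 0<z (x<y⇒0<y-x x<y))))

  inverse : ∀ {x} → 0# < x → ∃[ x⁻¹ ] (x⁻¹ * x ≈ 1#) × (0# < x⁻¹)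
  inverse {x} 0<x with #⇒invertible (#-sym (<⇒# 0<x))
  ... | x⁻¹ , eq , _ = x⁻¹ , x⁻¹*x≈1 , 0<x⁻¹
    where
    x⁻¹*x≈1 : x⁻¹ * x ≈ 1#
    x⁻¹*x≈1 = trans (*-congˡ (sym (x-0≈x x))) eq
    x⁻¹#0 : x⁻¹ # 0#
    x⁻¹#0 = invertibleˡ⇒# (x , trans (*-congˡ (x-0≈x x⁻¹)) (trans (*-comm x x⁻¹) x⁻¹*x≈1))
    0<x⁻¹ : 0# < x⁻¹
    0<x⁻¹ with #⇒<∨> x⁻¹#0
    ... | inj₂ 0<x⁻¹ = 0<x⁻¹
    ... | inj₁ x⁻¹<0 = contradiction
      (<-respˡ-≈ (trans (*-comm x x⁻¹) x⁻¹*x≈1) (<-respʳ-≈ (zeroʳ x) (*-monoˡ-< 0<x x⁻¹<0)))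
      (<⇒≤ 0<1)

  *-cancelˡ-< : ∀ {z x y} → 0# < z → z * x < z * y → x < y
  *-cancelˡ-< {z} 0<z zx<zy with inverse 0<z
  ... | z⁻¹ , z⁻¹*z≈1 , 0<z⁻¹ =
    <-respˡ-≈ (cancel _) (<-respʳ-≈ (cancel _) (*-monoˡ-< 0<z⁻¹ zx<zy))
    where
    cancel : ∀ x → z⁻¹ * (z * x) ≈ x
    cancel x = trans (sym (*-assoc z⁻¹ z x)) (trans (*-congʳ z⁻¹*z≈1) (*-identityˡ x))

  *-cancelˡ-≈ : ∀ {z x y} → 0# < z → z * x ≈ z * y → x ≈ y
  *-cancelˡ-≈ 0<z eq = ≤-antisym
    (λ y<x → <-irrefl (sym eq) (*-monoˡ-< 0<z y<x))
    (λ x<y → <-irrefl eq (*-monoˡ-< 0<z x<y))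

  -- The signs of `x` and `y` cannot be decided, but `x * y < 0#` makes the product invertible,
  -- hence `x` apart from zero; its sign is then known and `x` can be cancelled.
  *-nonneg : ∀ {x y} → 0# ≤ x → 0# ≤ y → 0# ≤ x * y
  *-nonneg {x} {y} 0≤x 0≤y xy<0 with #⇒invertible (<⇒# xy<0)
  ... | t , eq , _ with #⇒<∨> x#0
    where
    x#0 : x # 0#
    x#0 = invertibleˡ⇒# (t * y , (begin
      t * y * (x - 0#)   ≈⟨ *-congˡ (x-0≈x x) ⟩
      t * y * x          ≈⟨ solve 3 (λ t y x → t :* y :* x := t :* (x :* y)) refl t y x ⟩
      t * (x * y)        ≈⟨ *-congˡ (x-0≈x (x * y)) ⟨
      t * (x * y - 0#)   ≈⟨ eq ⟩
      1#                 ∎))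
  ...   | inj₁ x<0 = 0≤x x<0
  ...   | inj₂ 0<x = 0≤y (*-cancelˡ-< 0<x (<-respʳ-≈ (sym (zeroʳ x)) xy<0))

  *-monoˡ-≤ : ∀ {z x y} → 0# ≤ z → x ≤ y → z * x ≤ z * y
  *-monoˡ-≤ {z} {x} {y} 0≤z x≤y =
    ≤-trans (≤-reflexive (sym (+-identityˡ (z * x))))
      (≤-trans (+-monoˡ-≤ (z * x) (*-nonneg 0≤z (x≤y⇒0≤y-x x≤y)))
        (≤-reflexive (*-distribˡ-[y-x]+x z x y)))

  *-cancelˡ-≤ : ∀ {z x y} → 0# < z → z * x ≤ z * y → x ≤ y
  *-cancelˡ-≤ 0<z zx≤zy y<x = zx≤zy (*-monoˡ-< 0<z y<x)

  *-monoʳ-≤ : ∀ {z x y} → 0# ≤ z → x ≤ y → x * z ≤ y * z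
  *-monoʳ-≤ 0≤z x≤y = ≤-trans (≤-reflexive (*-comm _ _))
    (≤-trans (*-monoˡ-≤ 0≤z x≤y) (≤-reflexive (*-comm _ _)))

  *-mono-≤ : ∀ {x y u v} → 0# ≤ y → 0# ≤ u → x ≤ y → u ≤ v → x * u ≤ y * v
  *-mono-≤ 0≤y 0≤u x≤y u≤v = ≤-trans (*-monoʳ-≤ 0≤u x≤y) (*-monoˡ-≤ 0≤y u≤v)

  -- Turns iterated addition into a product, the form in which the ring solver and the distributive
  -- laws apply.
  ·≈* : ∀ n x → n · x ≈ n · 1# * x
  ·≈* n x = sym (trans (×-assoc-* n 1# x) (×-congʳ n (*-identityˡ x)))

  0≤1 : 0# ≤ 1#
  0≤1 = <⇒≤ 0<1

  0≤n·1 : ∀ n → 0# ≤ n · 1#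
  0≤n·1 zero    = ≤-refl
  0≤n·1 (suc n) = +-nonneg 0≤1 (0≤n·1 n)

  0<suc[n]·1 : ∀ n → 0# < suc n · 1#
  0<suc[n]·1 n = <-≤-trans 0<1 (x≤x+y (0≤n·1 n))

  0<n·1 : ∀ {n} → 1 ℕ.≤ n → 0# < n · 1#
  0<n·1 {suc n} _ = 0<suc[n]·1 n

  ·1-mono-≤ : ∀ {m n} → m ℕ.≤ n → m · 1# ≤ n · 1#
  ·1-mono-≤ {n = n} ℕ.z≤n = 0≤n·1 n
  ·1-mono-≤ (ℕ.s≤s m≤n)   = +-monoʳ-≤ 1# (·1-mono-≤ m≤n)

  ·1-mono-< : ∀ {m n} → m ℕ.< n → m · 1# < n · 1#
  ·1-mono-< {m} m<n = <-≤-trans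
    (<-respˡ-≈ (+-identityˡ _) (+-monoˡ-< (m · 1#) 0<1)) (·1-mono-≤ m<n)

  ·1-cancel-≤ : ∀ {m n} → m · 1# ≤ n · 1# → m ℕ.≤ n
  ·1-cancel-≤ m≤n = ℕ.≮⇒≥ (m≤n ∘ ·1-mono-<)

-- Univariate polynomials: formal calculus, identity principle, convexity.

module UnivariatePolynomials {c ℓ₁ ℓ₂ ℓ₃} (ℝ : RealNumbers c ℓ₁ ℓ₂ ℓ₃) where
  open RealNumbers ℝ
  open OrderedField ℝ
  open CommutativeRing commutativeRing using (ring; commutativeSemiring)
  open import Algebra.Properties.Ring ring using (+-cancelˡ; -1*x≈-x)
  open import Algebra.Properties.Semiring.Mult semiring hiding (_×_)
  open import Algebra.Solver.Ring.NaturalCoefficients.Default commutativeSemiring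
    using (solve; _:=_; _:+_; _:*_; con)
  open import Relation.Binary.Reasoning.Setoid setoid

  -- Coefficient lists start with the constant term; ⟦ p ⟧′ is the value of the
  -- formal derivative.
  ⟦_⟧ ⟦_⟧′ : List Carrier → Carrier → Carrier
  ⟦ [] ⟧ x    = 0#
  ⟦ a ∷ p ⟧ x = a + x * ⟦ p ⟧ x
  ⟦ [] ⟧′ x    = 0#
  ⟦ a ∷ p ⟧′ x = ⟦ p ⟧ x + x * ⟦ p ⟧′ x

  ⟦⟧-cong : ∀ p {x y} → x ≈ y → ⟦ p ⟧ x ≈ ⟦ p ⟧ y
  ⟦⟧-cong []      x≈y = refl
  ⟦⟧-cong (a ∷ p) x≈y = +-congˡ (*-cong x≈y (⟦⟧-cong p x≈y))

  ⟦a∷p⟧0≈a : ∀ a p → ⟦ a ∷ p ⟧ 0# ≈ a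
  ⟦a∷p⟧0≈a a p = trans (+-congˡ (zeroˡ _)) (+-identityʳ a)

  infixl 6 _⊕_
  infixl 7 _⊗_

  _⊕_ : List Carrier → List Carrier → List Carrier
  []      ⊕ q       = q
  (a ∷ p) ⊕ []      = a ∷ p
  (a ∷ p) ⊕ (b ∷ q) = (a + b) ∷ (p ⊕ q)

  _⊗_ : List Carrier → List Carrier → List Carrier
  []      ⊗ q = []
  (a ∷ p) ⊗ q = map (a *_) q ⊕ (0# ∷ p ⊗ q)

  translate : Carrier → List Carrier → List Carrier
  translate h []      = []
  translate h (a ∷ p) = (a ∷ translate h p) ⊕ map (h *_) (translate h p)

  ⟦⊕⟧ : ∀ p q x → ⟦ p ⊕ q ⟧ x ≈ ⟦ p ⟧ x + ⟦ q ⟧ x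
  ⟦⊕⟧ []      q       x = sym (+-identityˡ _)
  ⟦⊕⟧ (a ∷ p) []      x = sym (+-identityʳ _)
  ⟦⊕⟧ (a ∷ p) (b ∷ q) x = trans (+-congˡ (*-congˡ (⟦⊕⟧ p q x)))
    (solve 5 (λ a b x p q → (a :+ b) :+ x :* (p :+ q) := (a :+ x :* p) :+ (b :+ x :* q))
      refl a b x (⟦ p ⟧ x) (⟦ q ⟧ x))

  ⟦⊕⟧′ : ∀ p q x → ⟦ p ⊕ q ⟧′ x ≈ ⟦ p ⟧′ x + ⟦ q ⟧′ x
  ⟦⊕⟧′ []      q       x = sym (+-identityˡ _)
  ⟦⊕⟧′ (a ∷ p) []      x = sym (+-identityʳ _)
  ⟦⊕⟧′ (a ∷ p) (b ∷ q) x = trans (+-cong (⟦⊕⟧ p q x) (*-congˡ (⟦⊕⟧′ p q x)))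
    (solve 5 (λ x p q p′ q′ → (p :+ q) :+ x :* (p′ :+ q′) := (p :+ x :* p′) :+ (q :+ x :* q′))
      refl x (⟦ p ⟧ x) (⟦ q ⟧ x) (⟦ p ⟧′ x) (⟦ q ⟧′ x))

  ⟦map*⟧ : ∀ k p x → ⟦ map (k *_) p ⟧ x ≈ k * ⟦ p ⟧ x
  ⟦map*⟧ k []      x = sym (zeroʳ k)
  ⟦map*⟧ k (a ∷ p) x = trans (+-congˡ (*-congˡ (⟦map*⟧ k p x)))
    (solve 4 (λ k a x p → k :* a :+ x :* (k :* p) := k :* (a :+ x :* p)) refl k a x (⟦ p ⟧ x))

  ⟦map*⟧′ : ∀ k p x → ⟦ map (k *_) p ⟧′ x ≈ k * ⟦ p ⟧′ x
  ⟦map*⟧′ k []      x = sym (zeroʳ k)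
  ⟦map*⟧′ k (a ∷ p) x = trans (+-cong (⟦map*⟧ k p x) (*-congˡ (⟦map*⟧′ k p x)))
    (solve 4 (λ k x p p′ → k :* p :+ x :* (k :* p′) := k :* (p :+ x :* p′))
      refl k x (⟦ p ⟧ x) (⟦ p ⟧′ x))

  ⟦⊗⟧ : ∀ p q x → ⟦ p ⊗ q ⟧ x ≈ ⟦ p ⟧ x * ⟦ q ⟧ x
  ⟦⊗⟧ []      q x = sym (zeroˡ _)
  ⟦⊗⟧ (a ∷ p) q x = begin
    ⟦ map (a *_) q ⊕ (0# ∷ p ⊗ q) ⟧ x
      ≈⟨ ⟦⊕⟧ (map (a *_) q) (0# ∷ p ⊗ q) x ⟩
    ⟦ map (a *_) q ⟧ x + (0# + x * ⟦ p ⊗ q ⟧ x)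
      ≈⟨ +-cong (⟦map*⟧ a q x) (+-congˡ (*-congˡ (⟦⊗⟧ p q x))) ⟩
    a * ⟦ q ⟧ x + (0# + x * (⟦ p ⟧ x * ⟦ q ⟧ x))
      ≈⟨ solve 4 (λ a x p q → a :* q :+ (con 0 :+ x :* (p :* q)) := (a :+ x :* p) :* q)
           refl a x (⟦ p ⟧ x) (⟦ q ⟧ x) ⟩
    (a + x * ⟦ p ⟧ x) * ⟦ q ⟧ x ∎

  ⟦⊗⟧′ : ∀ p q x → ⟦ p ⊗ q ⟧′ x ≈ ⟦ p ⟧′ x * ⟦ q ⟧ x + ⟦ p ⟧ x * ⟦ q ⟧′ x
  ⟦⊗⟧′ []      q x = solve 2 (λ q q′ → con 0 := con 0 :* q :+ con 0 :* q′) refl (⟦ q ⟧ x) (⟦ q ⟧′ x)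
  ⟦⊗⟧′ (a ∷ p) q x = begin
    ⟦ map (a *_) q ⊕ (0# ∷ p ⊗ q) ⟧′ x
      ≈⟨ ⟦⊕⟧′ (map (a *_) q) (0# ∷ p ⊗ q) x ⟩
    ⟦ map (a *_) q ⟧′ x + (⟦ p ⊗ q ⟧ x + x * ⟦ p ⊗ q ⟧′ x)
      ≈⟨ +-cong (⟦map*⟧′ a q x) (+-cong (⟦⊗⟧ p q x) (*-congˡ (⟦⊗⟧′ p q x))) ⟩
    a * ⟦ q ⟧′ x + (⟦ p ⟧ x * ⟦ q ⟧ x + x * (⟦ p ⟧′ x * ⟦ q ⟧ x + ⟦ p ⟧ x * ⟦ q ⟧′ x))
      ≈⟨ solve 6 (λ a x p p′ q q′ →
             a :* q′ :+ (p :* q :+ x :* (p′ :* q :+ p :* q′))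
             := (p :+ x :* p′) :* q :+ (a :+ x :* p) :* q′)
           refl a x (⟦ p ⟧ x) (⟦ p ⟧′ x) (⟦ q ⟧ x) (⟦ q ⟧′ x) ⟩
    (⟦ p ⟧ x + x * ⟦ p ⟧′ x) * ⟦ q ⟧ x + (a + x * ⟦ p ⟧ x) * ⟦ q ⟧′ x ∎

  ⟦translate⟧ : ∀ h p x → ⟦ translate h p ⟧ x ≈ ⟦ p ⟧ (x + h)
  ⟦translate⟧ h []      x = refl
  ⟦translate⟧ h (a ∷ p) x = begin
    ⟦ (a ∷ q) ⊕ map (h *_) q ⟧ x             ≈⟨ ⟦⊕⟧ (a ∷ q) (map (h *_) q) x ⟩
    (a + x * ⟦ q ⟧ x) + ⟦ map (h *_) q ⟧ x   ≈⟨ +-congˡ (⟦map*⟧ h q x) ⟩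
    (a + x * ⟦ q ⟧ x) + h * ⟦ q ⟧ x
      ≈⟨ solve 4 (λ a x q h → (a :+ x :* q) :+ h :* q := a :+ (x :+ h) :* q) refl a x (⟦ q ⟧ x) h ⟩
    a + (x + h) * ⟦ q ⟧ x                    ≈⟨ +-congˡ (*-congˡ (⟦translate⟧ h p x)) ⟩
    a + (x + h) * ⟦ p ⟧ (x + h)              ∎
    where q = translate h p

  -- reciprocal n = 1 / (n + 1)
  reciprocal : ℕ → Carrier
  reciprocal n = proj₁ (inverse (0<suc[n]·1 n))

  reciprocal-inverseˡ : ∀ n → reciprocal n * (suc n · 1#) ≈ 1#
  reciprocal-inverseˡ n = proj₁ (proj₂ (inverse (0<suc[n]·1 n)))

  0<reciprocal : ∀ n → 0# < reciprocal n
  0<reciprocal n = proj₂ (proj₂ (inverse (0<suc[n]·1 n)))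

  divideFrom : ℕ → List Carrier → List Carrier
  divideFrom k []      = []
  divideFrom k (a ∷ p) = reciprocal k * a ∷ divideFrom (suc k) p

  antiderivative : List Carrier → List Carrier
  antiderivative p = 0# ∷ divideFrom 0 p

  -- With Q = `divideFrom k p`, this says that x^(k+1) Q has derivative x^k p, with x^k cancelled so
  -- that the induction involves no powers. The antiderivative is the case `k = 0`.
  ⟦divideFrom⟧ : ∀ k p x →
    suc k · 1# * ⟦ divideFrom k p ⟧ x + x * ⟦ divideFrom k p ⟧′ x ≈ ⟦ p ⟧ x
  ⟦divideFrom⟧ k []      x = solve 2 (λ n x → n :* con 0 :+ x :* con 0 := con 0) refl (suc k · 1#) x
  ⟦divideFrom⟧ k (a ∷ p) x = begin
    (1# + k · 1#) * (r * a + x * q) + x * (q + x * q′)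
      ≈⟨ solve 6 (λ n r a x q q′ →
             (con 1 :+ n) :* (r :* a :+ x :* q) :+ x :* (q :+ x :* q′)
             := r :* (con 1 :+ n) :* a :+ x :* ((con 1 :+ (con 1 :+ n)) :* q :+ x :* q′))
           refl (k · 1#) r a x q q′ ⟩
    r * (suc k · 1#) * a + x * (suc (suc k) · 1# * q + x * q′)
      ≈⟨ +-cong (trans (*-congʳ (reciprocal-inverseˡ k)) (*-identityˡ a))
                (*-congˡ (⟦divideFrom⟧ (suc k) p x)) ⟩
    a + x * ⟦ p ⟧ x ∎
    where
    r  = reciprocal k
    q  = ⟦ divideFrom (suc k) p ⟧ x
    q′ = ⟦ divideFrom (suc k) p ⟧′ x

  ⟦antiderivative⟧′ : ∀ p x → ⟦ antiderivative p ⟧′ x ≈ ⟦ p ⟧ x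
  ⟦antiderivative⟧′ p x = trans
    (+-congʳ (trans (sym (*-identityˡ _)) (*-congʳ (sym (+-identityʳ 1#)))))
    (⟦divideFrom⟧ 0 p x)

  -- The identity principle

  -- Synthetic division: `quotient r p` is the quotient of `a ∷ p` by X - r. It is the same for
  -- every constant term `a`, so only the tail is passed.
  quotient : Carrier → List Carrier → List Carrier
  quotient r []      = []
  quotient r (a ∷ p) = ⟦ a ∷ p ⟧ r ∷ quotient r p

  length-quotient : ∀ r p → length (quotient r p) ≡ length p
  length-quotient r []      = ≡.refl
  length-quotient r (a ∷ p) = ≡.cong suc (length-quotient r p)

  -- Division by X - r, with both sides moved so that no subtraction occurs.
  quotient-remainder : ∀ r a p x →
    ⟦ a ∷ p ⟧ x + r * ⟦ quotient r p ⟧ x ≈ ⟦ a ∷ p ⟧ r + x * ⟦ quotient r p ⟧ x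
  quotient-remainder r a []      x =
    solve 3 (λ a r x → (a :+ x :* con 0) :+ r :* con 0 := (a :+ r :* con 0) :+ x :* con 0) refl a r x
  quotient-remainder r a (b ∷ p) x = begin
    (a + x * s) + r * (⟦ b ∷ p ⟧ r + x * q)
      ≈⟨ solve 6 (λ a x s r t q → (a :+ x :* s) :+ r :* (t :+ x :* q)
                               := (a :+ r :* t) :+ x :* (s :+ r :* q))
           refl a x s r (⟦ b ∷ p ⟧ r) q ⟩
    (a + r * ⟦ b ∷ p ⟧ r) + x * (s + r * q)
      ≈⟨ +-congˡ (*-congˡ (quotient-remainder r b p x)) ⟩
    (a + r * ⟦ b ∷ p ⟧ r) + x * (⟦ b ∷ p ⟧ r + x * q) ∎
    where
    s = ⟦ b ∷ p ⟧ x
    q = ⟦ quotient r p ⟧ x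

  ⟦zeros⟧ : ∀ {p} → All (_≈ 0#) p → ∀ x → ⟦ p ⟧ x ≈ 0#
  ⟦zeros⟧ []           x = refl
  ⟦zeros⟧ (a≈0 ∷ p≈0) x = trans (+-cong a≈0 (trans (*-congˡ (⟦zeros⟧ p≈0 x)) (zeroʳ x)))
    (+-identityˡ 0#)

  zeros-∷ : ∀ {a p} r → ⟦ a ∷ p ⟧ r ≈ 0# → All (_≈ 0#) p → All (_≈ 0#) (a ∷ p)
  zeros-∷ {a} {p} r eq p≈0 = trans a≈ eq ∷ p≈0
    where
    a≈ : a ≈ a + r * ⟦ p ⟧ r
    a≈ = sym (trans (+-congˡ (trans (*-congˡ (⟦zeros⟧ p≈0 r)) (zeroʳ r))) (+-identityʳ a))

  zeros-quotient⁻ : ∀ r p → All (_≈ 0#) (quotient r p) → All (_≈ 0#) p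
  zeros-quotient⁻ r []      []         = []
  zeros-quotient⁻ r (a ∷ p) (eq ∷ q≈0) = zeros-∷ r eq (zeros-quotient⁻ r p q≈0)

  -- Divide out the root `r`: at an integer `s` above `r` the factor s - r is positive and cancels,
  -- so the quotient vanishes from `suc r` on. The length `n` is the measure of the recursion, since
  -- the quotient is not a sublist.
  vanishing⇒zeros : ∀ n p → length p ≡ n → ∀ r →
    (∀ s → r ℕ.≤ s → ⟦ p ⟧ (s · 1#) ≈ 0#) → All (_≈ 0#) p
  vanishing⇒zeros n       []      _   r p≈0 = []
  vanishing⇒zeros (suc n) (a ∷ p) len r p≈0 = zeros-∷ (r · 1#) (p≈0 r ℕ.≤-refl)
    (zeros-quotient⁻ (r · 1#) p
      (vanishing⇒zeros n (quotient (r · 1#) p)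
        (≡.trans (length-quotient (r · 1#) p) (ℕ.suc-injective len)) (suc r) q≈0))
    where
    q≈0 : ∀ s → suc r ℕ.≤ s → ⟦ quotient (r · 1#) p ⟧ (s · 1#) ≈ 0#
    q≈0 s r<s with ℕ.m≤n⇒∃[o]m+o≡n r<s
    ... | d , ≡.refl = *-cancelˡ-≈ (0<suc[n]·1 d) (trans dq≈0 (sym (zeroʳ (suc d · 1#))))
      where
      q = ⟦ quotient (r · 1#) p ⟧ (s · 1#)
      dq≈0 : suc d · 1# * q ≈ 0#
      dq≈0 = +-cancelˡ (r · 1# * q) _ _ (begin
        r · 1# * q + suc d · 1# * q                  ≈⟨ distribʳ q (r · 1#) (suc d · 1#) ⟨
        (r · 1# + suc d · 1#) * q                    ≈⟨ *-congʳ (×-homo-+ 1# r (suc d)) ⟨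
        (r ℕ.+ suc d) · 1# * q                       ≡⟨ ≡.cong (λ m → m · 1# * q) (ℕ.+-suc r d) ⟩
        s · 1# * q                                   ≈⟨ +-identityˡ _ ⟨
        0# + s · 1# * q                              ≈⟨ +-congʳ (p≈0 r ℕ.≤-refl) ⟨
        ⟦ a ∷ p ⟧ (r · 1#) + s · 1# * q              ≈⟨ quotient-remainder (r · 1#) a p (s · 1#) ⟨
        ⟦ a ∷ p ⟧ (s · 1#) + r · 1# * q              ≈⟨ +-congʳ (p≈0 s (ℕ.<⇒≤ r<s)) ⟩
        0# + r · 1# * q                              ≈⟨ +-comm 0# _ ⟩
        r · 1# * q + 0#                              ∎)

  IsPolynomial : (Carrier → Carrier) → Set _
  IsPolynomial f = ∃[ p ] ∀ x → f x ≈ ⟦ p ⟧ x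

  polynomial-const : ∀ a → IsPolynomial (λ _ → a)
  polynomial-const a = a ∷ [] , λ x → sym (trans (+-congˡ (zeroʳ x)) (+-identityʳ a))

  polynomial-id : IsPolynomial (λ x → x)
  polynomial-id = 0# ∷ 1# ∷ [] ,
    solve 1 (λ x → x := con 0 :+ x :* (con 1 :+ x :* con 0)) refl

  polynomial-+ : ∀ {f g} → IsPolynomial f → IsPolynomial g → IsPolynomial (λ x → f x + g x)
  polynomial-+ (p , f≈) (q , g≈) = p ⊕ q ,
    λ x → trans (+-cong (f≈ x) (g≈ x)) (sym (⟦⊕⟧ p q x))

  polynomial-* : ∀ {f g} → IsPolynomial f → IsPolynomial g → IsPolynomial (λ x → f x * g x)
  polynomial-* (p , f≈) (q , g≈) = p ⊗ q ,
    λ x → trans (*-cong (f≈ x) (g≈ x)) (sym (⟦⊗⟧ p q x))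

  polynomial-^ : ∀ {f} → IsPolynomial f → ∀ n → IsPolynomial (λ x → f x ^ n)
  polynomial-^ f-poly zero    = polynomial-const 1#
  polynomial-^ f-poly (suc n) = polynomial-* f-poly (polynomial-^ f-poly n)

  x+-1*y≈0⇒x≈y : ∀ {x y} → x + - 1# * y ≈ 0# → x ≈ y
  x+-1*y≈0⇒x≈y {x} {y} eq = begin
    x                   ≈⟨ [x-y]+y≈x x y ⟨
    (x + - y) + y       ≈⟨ +-congʳ (+-congˡ (-1*x≈-x y)) ⟨
    (x + - 1# * y) + y  ≈⟨ +-congʳ eq ⟩
    0# + y              ≈⟨ +-identityˡ y ⟩
    y                   ∎

  x≈y⇒x+-1*y≈0 : ∀ {x y} → x ≈ y → x + - 1# * y ≈ 0#
  x≈y⇒x+-1*y≈0 {x} {y} x≈y = trans (+-cong x≈y (-1*x≈-x y)) (-‿inverseʳ y)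

  ⟦⟧-ext : ∀ p q → (∀ n → 1 ℕ.≤ n → ⟦ p ⟧ (n · 1#) ≈ ⟦ q ⟧ (n · 1#)) → ∀ x → ⟦ p ⟧ x ≈ ⟦ q ⟧ x
  ⟦⟧-ext p q p≈q x = x+-1*y≈0⇒x≈y (trans (sym (difference x))
    (⟦zeros⟧ (vanishing⇒zeros _ d ≡.refl 1
      (λ n 1≤n → trans (difference (n · 1#)) (x≈y⇒x+-1*y≈0 (p≈q n 1≤n)))) x))
    where
    d = p ⊕ map (- 1# *_) q
    difference : ∀ x → ⟦ d ⟧ x ≈ ⟦ p ⟧ x + - 1# * ⟦ q ⟧ x
    difference x = trans (⟦⊕⟧ p (map (- 1# *_) q) x) (+-congˡ (⟦map*⟧ (- 1#) q x))

  polynomial-ext : ∀ {f g} → IsPolynomial f → IsPolynomial g →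
    (∀ n → 1 ℕ.≤ n → f (n · 1#) ≈ g (n · 1#)) → ∀ x → f x ≈ g x
  polynomial-ext (p , f≈) (q , g≈) f≈g x = trans (f≈ x) (trans
    (⟦⟧-ext p q (λ n 1≤n → trans (sym (f≈ _)) (trans (f≈g n 1≤n) (g≈ _))) x)
    (sym (g≈ x)))

  -- Derivatives

  -- A single coefficient list must account for both functions, so the derivative is the formal one
  -- and no limit enters.
  HasDerivative : (Carrier → Carrier) → (Carrier → Carrier) → Set _
  HasDerivative f f′ = ∃[ p ] (∀ x → f x ≈ ⟦ p ⟧ x) × (∀ x → f′ x ≈ ⟦ p ⟧′ x)

  derivative-cong : ∀ {f g f′ g′} → (∀ x → f x ≈ g x) → (∀ x → f′ x ≈ g′ x) →
    HasDerivative f f′ → HasDerivative g g′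
  derivative-cong f≈g f′≈g′ (p , f≈ , f′≈) =
    p , (λ x → trans (sym (f≈g x)) (f≈ x)) , (λ x → trans (sym (f′≈g′ x)) (f′≈ x))

  derivative-const : ∀ a → HasDerivative (λ _ → a) (λ _ → 0#)
  derivative-const a = a ∷ [] , proj₂ (polynomial-const a) ,
    solve 1 (λ x → con 0 := con 0 :+ x :* con 0) refl

  derivative-id : HasDerivative (λ x → x) (λ _ → 1#)
  derivative-id = 0# ∷ 1# ∷ [] , proj₂ polynomial-id ,
    solve 1 (λ x → con 1 := (con 1 :+ x :* con 0) :+ x :* (con 0 :+ x :* con 0)) refl

  derivative-+ : ∀ {f g f′ g′} → HasDerivative f f′ → HasDerivative g g′ →
    HasDerivative (λ x → f x + g x) (λ x → f′ x + g′ x)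
  derivative-+ (p , f≈ , f′≈) (q , g≈ , g′≈) = p ⊕ q ,
    proj₂ (polynomial-+ (p , f≈) (q , g≈)) ,
    λ x → trans (+-cong (f′≈ x) (g′≈ x)) (sym (⟦⊕⟧′ p q x))

  derivative-* : ∀ {f g f′ g′} → HasDerivative f f′ → HasDerivative g g′ →
    HasDerivative (λ x → f x * g x) (λ x → f′ x * g x + f x * g′ x)
  derivative-* (p , f≈ , f′≈) (q , g≈ , g′≈) = p ⊗ q ,
    proj₂ (polynomial-* (p , f≈) (q , g≈)) ,
    λ x → trans (+-cong (*-cong (f′≈ x) (g≈ x)) (*-cong (f≈ x) (g′≈ x))) (sym (⟦⊗⟧′ p q x))

  derivative-scale : ∀ k {f f′} → HasDerivative f f′ → HasDerivative (λ x → k * f x) (λ x → k * f′ x)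
  derivative-scale k (p , f≈ , f′≈) = map (k *_) p ,
    (λ x → trans (*-congˡ (f≈ x)) (sym (⟦map*⟧ k p x))) ,
    (λ x → trans (*-congˡ (f′≈ x)) (sym (⟦map*⟧′ k p x)))

  derivative-∘-affine : ∀ k h {f f′} → HasDerivative f f′ →
    HasDerivative (λ x → f (k * x + h)) (λ x → k * f′ (k * x + h))
  derivative-∘-affine k h (p , f≈ , f′≈) =
    derivative-cong (λ x → sym (f≈ _)) (λ x → *-congˡ (sym (f′≈ _))) (affine p)
    where
    inner : HasDerivative (λ x → k * x + h) (λ _ → k)
    inner = derivative-cong (λ _ → refl)
      (λ _ → trans (+-identityʳ _) (*-identityʳ k))
      (derivative-+ (derivative-scale k derivative-id) (derivative-const h))
    affine : ∀ p → HasDerivative (λ x → ⟦ p ⟧ (k * x + h)) (λ x → k * ⟦ p ⟧′ (k * x + h))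
    affine []      = derivative-cong (λ _ → refl) (λ _ → sym (zeroʳ k)) (derivative-const 0#)
    affine (a ∷ p) = derivative-cong (λ _ → refl)
      (λ x → solve 4 (λ k y q q′ → con 0 :+ (k :* q :+ y :* (k :* q′)) := k :* (q :+ y :* q′))
        refl k (k * x + h) (⟦ p ⟧ (k * x + h)) (⟦ p ⟧′ (k * x + h)))
      (derivative-+ (derivative-const a) (derivative-* inner (affine p)))

  derivative-^ : ∀ {f f′} → HasDerivative f f′ → ∀ n →
    HasDerivative (λ x → f x ^ suc n) (λ x → suc n · 1# * (f′ x * f x ^ n))
  derivative-^ {f} {f′} d zero = derivative-cong (λ _ → refl)
    (λ x → solve 2 (λ y z → z :* con 1 :+ y :* con 0 := (con 1 :+ con 0) :* (z :* con 1))
      refl (f x) (f′ x))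
    (derivative-* d (derivative-const 1#))
  derivative-^ {f} {f′} d (suc n) = derivative-cong (λ _ → refl)
    (λ x → solve 4 (λ y z w m → z :* (y :* w) :+ y :* (m :* (z :* w)) := (con 1 :+ m) :* (z :* (y :* w)))
      refl (f x) (f′ x) (f x ^ n) (suc n · 1#))
    (derivative-* d (derivative-^ d n))

  derivative-antiderivative : ∀ p → HasDerivative ⟦ antiderivative p ⟧ ⟦ p ⟧
  derivative-antiderivative p =
    antiderivative p , (λ _ → refl) , (λ x → sym (⟦antiderivative⟧′ p x))

  -- Coefficients of k p + X p′, the counterpart of `divideFrom`. For `k = 1` this is the derivative
  -- of `a ∷ p` as a coefficient list, to which the identity principle applies.
  weightFrom : ℕ → List Carrier → List Carrier
  weightFrom k []      = []
  weightFrom k (a ∷ p) = k · 1# * a ∷ weightFrom (suc k) p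

  ⟦weightFrom⟧ : ∀ k p x → ⟦ weightFrom k p ⟧ x ≈ k · 1# * ⟦ p ⟧ x + x * ⟦ p ⟧′ x
  ⟦weightFrom⟧ k []      x = solve 2 (λ k x → con 0 := k :* con 0 :+ x :* con 0) refl (k · 1#) x
  ⟦weightFrom⟧ k (a ∷ p) x = trans (+-congˡ (*-congˡ (⟦weightFrom⟧ (suc k) p x)))
    (solve 5 (λ k a x q q′ → k :* a :+ x :* ((con 1 :+ k) :* q :+ x :* q′)
                          := k :* (a :+ x :* q) :+ x :* (q :+ x :* q′))
      refl (k · 1#) a x (⟦ p ⟧ x) (⟦ p ⟧′ x))

  zeros-weightFrom⁻ : ∀ k p → All (_≈ 0#) (weightFrom (suc k) p) → All (_≈ 0#) p
  zeros-weightFrom⁻ k []      []          = []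
  zeros-weightFrom⁻ k (a ∷ p) (ka≈0 ∷ eq) =
    *-cancelˡ-≈ (0<suc[n]·1 k) (trans ka≈0 (sym (zeroʳ _))) ∷ zeros-weightFrom⁻ (suc k) p eq

  -- Characteristic zero: by the identity principle the coefficients of the derivative vanish, and
  -- these are positive integer multiples of the nonconstant coefficients of the polynomial.
  zero-derivative : ∀ p → (∀ x → ⟦ p ⟧′ x ≈ 0#) → ∀ x → ⟦ p ⟧ x ≈ ⟦ p ⟧ 0#
  zero-derivative []      _     x = refl
  zero-derivative (a ∷ p) p′≈0 x = +-congˡ (trans (x*⟦p⟧≈0 x) (sym (x*⟦p⟧≈0 0#)))
    where
    p-zeros : All (_≈ 0#) p
    p-zeros = zeros-weightFrom⁻ 0 p (vanishing⇒zeros _ (weightFrom 1 p) ≡.refl 0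
      (λ s _ → trans (⟦weightFrom⟧ 1 p (s · 1#))
        (trans (+-congʳ (trans (*-congʳ (+-identityʳ 1#)) (*-identityˡ _))) (p′≈0 (s · 1#)))))
    x*⟦p⟧≈0 : ∀ x → x * ⟦ p ⟧ x ≈ 0#
    x*⟦p⟧≈0 x = trans (*-congˡ (⟦zeros⟧ p-zeros x)) (zeroʳ x)

  derivative-unique : ∀ {f g f′ g′} → HasDerivative f f′ → HasDerivative g g′ →
    (∀ x → f′ x ≈ g′ x) → f 0# ≈ g 0# → ∀ x → f x ≈ g x
  derivative-unique {f} {g} df dg f′≈g′ f0≈g0 x
    with derivative-+ df (derivative-scale (- 1#) dg)
  ... | p , d≈ , d′≈ = x+-1*y≈0⇒x≈y (begin
    f x + - 1# * g x      ≈⟨ d≈ x ⟩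
    ⟦ p ⟧ x               ≈⟨ zero-derivative p (λ y → trans (sym (d′≈ y)) (x≈y⇒x+-1*y≈0 (f′≈g′ y))) x ⟩
    ⟦ p ⟧ 0#              ≈⟨ d≈ 0# ⟨
    f 0# + - 1# * g 0#    ≈⟨ x≈y⇒x+-1*y≈0 f0≈g0 ⟩
    0#                    ∎)

  -- Polynomials with nonnegative coefficients

  ⟦nonneg⟧ : ∀ {p} → All (0# ≤_) p → ∀ {x} → 0# ≤ x → 0# ≤ ⟦ p ⟧ x
  ⟦nonneg⟧ []          0≤x = ≤-refl
  ⟦nonneg⟧ (0≤a ∷ 0≤p) 0≤x = +-nonneg 0≤a (*-nonneg 0≤x (⟦nonneg⟧ 0≤p 0≤x))

  ⟦⟧-mono-≤ : ∀ {p} → All (0# ≤_) p → ∀ {x y} → 0# ≤ x → x ≤ y → ⟦ p ⟧ x ≤ ⟦ p ⟧ y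
  ⟦⟧-mono-≤ []          0≤x x≤y = ≤-refl
  ⟦⟧-mono-≤ (0≤a ∷ 0≤p) 0≤x x≤y = +-monoʳ-≤ _
    (*-mono-≤ (≤-trans 0≤x x≤y) (⟦nonneg⟧ 0≤p 0≤x) x≤y (⟦⟧-mono-≤ 0≤p 0≤x x≤y))

  -- Nonnegative coefficients make the polynomial convex for nonnegative arguments, so it lies above
  -- its tangent at `x`. Together with `⟦⟧′-upper`, which uses the tangent at `x + h`, this takes
  -- the place of the mean value theorem.
  ⟦⟧′-lower : ∀ {p} → All (0# ≤_) p → ∀ {x h} → 0# ≤ x → 0# ≤ h →
    ⟦ p ⟧ x + h * ⟦ p ⟧′ x ≤ ⟦ p ⟧ (x + h)
  ⟦⟧′-lower []                  {x} {h} _   _   =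
    ≤-reflexive (solve 1 (λ h → con 0 :+ h :* con 0 := con 0) refl h)
  ⟦⟧′-lower {a ∷ p} (0≤a ∷ 0≤p) {x} {h} 0≤x 0≤h = ≤R.begin
    (a + x * q) + h * (q + x * q′)
      ≤R.≈⟨ solve 5 (λ a x q h q′ → (a :+ x :* q) :+ h :* (q :+ x :* q′)
                               := a :+ (x :* (q :+ h :* q′) :+ h :* q)) refl a x q h q′ ⟩
    a + (x * (q + h * q′) + h * q)
      ≤R.≤⟨ +-monoʳ-≤ a (+-mono-≤ (*-monoˡ-≤ 0≤x (⟦⟧′-lower 0≤p 0≤x 0≤h))
                             (*-monoˡ-≤ 0≤h (⟦⟧-mono-≤ 0≤p 0≤x (x≤x+y 0≤h)))) ⟩
    a + (x * r + h * r)
      ≤R.≈⟨ +-congˡ (distribʳ r x h) ⟨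
    a + (x + h) * r ≤R.∎
    where
    module ≤R = ≤-Reasoning
    q  = ⟦ p ⟧ x
    q′ = ⟦ p ⟧′ x
    r  = ⟦ p ⟧ (x + h)

  ⟦⟧′-upper : ∀ {p} → All (0# ≤_) p → ∀ {x h} → 0# ≤ x → 0# ≤ h →
    ⟦ p ⟧ (x + h) ≤ ⟦ p ⟧ x + h * ⟦ p ⟧′ (x + h)
  ⟦⟧′-upper []                  {x} {h} _   _   =
    ≤-reflexive (solve 1 (λ h → con 0 := con 0 :+ h :* con 0) refl h)
  ⟦⟧′-upper {a ∷ p} (0≤a ∷ 0≤p) {x} {h} 0≤x 0≤h = ≤R.begin
    a + (x + h) * r
      ≤R.≈⟨ +-congˡ (distribʳ r x h) ⟩
    a + (x * r + h * r)
      ≤R.≤⟨ +-monoʳ-≤ a (+-monoˡ-≤ (h * r) (*-monoˡ-≤ 0≤x (⟦⟧′-upper 0≤p 0≤x 0≤h))) ⟩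
    a + (x * (q + h * r′) + h * r)
      ≤R.≤⟨ +-monoʳ-≤ a (+-monoˡ-≤ (h * r) (≤R.begin
        x * (q + h * r′)       ≤R.≈⟨ distribˡ x q (h * r′) ⟩
        x * q + x * (h * r′)   ≤R.≤⟨ +-monoʳ-≤ (x * q)
          (*-monoʳ-≤ (*-nonneg 0≤h 0≤r′) (x≤x+y 0≤h)) ⟩
        x * q + (x + h) * (h * r′) ≤R.∎)) ⟩
    a + ((x * q + (x + h) * (h * r′)) + h * r)
      ≤R.≈⟨ solve 6 (λ a x q h r r′ → a :+ ((x :* q :+ (x :+ h) :* (h :* r′)) :+ h :* r)
                               := (a :+ x :* q) :+ h :* (r :+ (x :+ h) :* r′)) refl a x q h r r′ ⟩
    (a + x * q) + h * (r + (x + h) * r′) ≤R.∎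
    where
    module ≤R = ≤-Reasoning
    q  = ⟦ p ⟧ x
    r  = ⟦ p ⟧ (x + h)
    r′ = ⟦ p ⟧′ (x + h)
    ⟦nonneg⟧′ : ∀ {p} → All (0# ≤_) p → ∀ {x} → 0# ≤ x → 0# ≤ ⟦ p ⟧′ x
    ⟦nonneg⟧′ []          0≤x = ≤-refl
    ⟦nonneg⟧′ (0≤a ∷ 0≤p) 0≤x = +-nonneg (⟦nonneg⟧ 0≤p 0≤x) (*-nonneg 0≤x (⟦nonneg⟧′ 0≤p 0≤x))
    0≤r′ : 0# ≤ r′
    0≤r′ = ⟦nonneg⟧′ 0≤p (+-nonneg 0≤x 0≤h)

  nonneg-⊕ : ∀ {p q} → All (0# ≤_) p → All (0# ≤_) q → All (0# ≤_) (p ⊕ q)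
  nonneg-⊕ []          0≤q         = 0≤q
  nonneg-⊕ (0≤a ∷ 0≤p) []          = 0≤a ∷ 0≤p
  nonneg-⊕ (0≤a ∷ 0≤p) (0≤b ∷ 0≤q) = +-nonneg 0≤a 0≤b ∷ nonneg-⊕ 0≤p 0≤q

  nonneg-map* : ∀ {k p} → 0# ≤ k → All (0# ≤_) p → All (0# ≤_) (map (k *_) p)
  nonneg-map* 0≤k []          = []
  nonneg-map* 0≤k (0≤a ∷ 0≤p) = *-nonneg 0≤k 0≤a ∷ nonneg-map* 0≤k 0≤p

  nonneg-translate : ∀ {h p} → 0# ≤ h → All (0# ≤_) p → All (0# ≤_) (translate h p)
  nonneg-translate 0≤h []          = []
  nonneg-translate 0≤h (0≤a ∷ 0≤p) =
    nonneg-⊕ (0≤a ∷ nonneg-translate 0≤h 0≤p) (nonneg-map* 0≤h (nonneg-translate 0≤h 0≤p))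

  nonneg-antiderivative : ∀ {p} → All (0# ≤_) p → All (0# ≤_) (antiderivative p)
  nonneg-antiderivative 0≤p = ≤-refl ∷ go 0 0≤p
    where
    go : ∀ k {p} → All (0# ≤_) p → All (0# ≤_) (divideFrom k p)
    go k []          = []
    go k (0≤a ∷ 0≤p) = *-nonneg (<⇒≤ (0<reciprocal k)) 0≤a ∷ go (suc k) 0≤p

-- The iterated integral `W` as a polynomial in its arguments.

module VolumeFunction {c ℓ₁ ℓ₂ ℓ₃} (ℝ : RealNumbers c ℓ₁ ℓ₂ ℓ₃) where
  open RealNumbers ℝ
  open OrderedField ℝ
  open UnivariatePolynomials ℝ
  open import Relation.Binary.Reasoning.Setoid setoid

  -- W (x₁ ∷ … ∷ xₙ ∷ []) is the iterated integral ∫₀^x₁ W (t + x₂ ∷ x₃ ∷ … ∷ xₙ ∷ []) dt,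
  -- and integrand (x₂ ∷ … ∷ xₙ ∷ []) lists the coefficients of its integrand in t.
  integrand : List Carrier → List Carrier
  integrand []       = 1# ∷ []
  integrand (x ∷ xs) = translate x (antiderivative (integrand xs))

  W : List Carrier → Carrier
  W []       = 1#
  W (x ∷ xs) = ⟦ antiderivative (integrand xs) ⟧ x

  -- Gives the arguments of `W` after differentiation in the first one. On the empty list nothing
  -- absorbs `a`, and `W [] = 1#` is the right integrand in dimension one.
  addHead : Carrier → List Carrier → List Carrier
  addHead a []       = []
  addHead a (x ∷ xs) = a + x ∷ xs

  ⟦integrand⟧ : ∀ xs a → ⟦ integrand xs ⟧ a ≈ W (addHead a xs)
  ⟦integrand⟧ []       a = trans (+-congˡ (zeroʳ a)) (+-identityʳ 1#)
  ⟦integrand⟧ (x ∷ xs) a = ⟦translate⟧ x (antiderivative (integrand xs)) a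

  W-congʰ : ∀ {a b} → a ≈ b → ∀ xs → W (a ∷ xs) ≈ W (b ∷ xs)
  W-congʰ a≈b xs = ⟦⟧-cong (antiderivative (integrand xs)) a≈b

  W-addHead-cong : ∀ {a b} → a ≈ b → ∀ xs → W (addHead a xs) ≈ W (addHead b xs)
  W-addHead-cong a≈b []       = refl
  W-addHead-cong a≈b (x ∷ xs) = W-congʰ (+-congʳ a≈b) xs

  W-derivative : ∀ xs → HasDerivative (λ a → W (a ∷ xs)) (λ a → W (addHead a xs))
  W-derivative xs = derivative-cong (λ _ → refl) (⟦integrand⟧ xs)
    (derivative-antiderivative (integrand xs))

  W-0∷ : ∀ xs → W (0# ∷ xs) ≈ 0#
  W-0∷ xs = ⟦a∷p⟧0≈a 0# (divideFrom 0 (integrand xs))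

  -- Coefficient lists are not compared: both sides are polynomial in the head and vanish at zero,
  -- and their derivatives agree by induction on the dimension.
  W-cong-∷ : ∀ {a b xs ys} → a ≈ b → ListPointwise.Pointwise _≈_ xs ys → W (a ∷ xs) ≈ W (b ∷ ys)
  W-addHead-cong₂ : ∀ a {xs ys} → ListPointwise.Pointwise _≈_ xs ys → W (addHead a xs) ≈ W (addHead a ys)
  W-cong-∷ {a} {xs = xs} {ys} a≈b xs≈ys = trans
    (derivative-unique (W-derivative xs) (W-derivative ys) (λ t → W-addHead-cong₂ t xs≈ys)
      (trans (W-0∷ xs) (sym (W-0∷ ys))) a)
    (W-congʰ a≈b ys)
  W-addHead-cong₂ a ListPointwise.[]             = refl
  W-addHead-cong₂ a (x≈y ListPointwise.∷ xs≈ys) = W-cong-∷ (+-congˡ x≈y) xs≈ys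

  -- Differentiation in `a` lowers the dimension by one and releases one factor `k` from the scaled
  -- head; both sides vanish at `a = 0#`.
  W-homogeneous-∷ : ∀ k xs a →
    W (k * a ∷ map (k *_) xs) ≈ k ^ suc (length xs) * W (a ∷ xs)
  W-homogeneous-addHead : ∀ k xs a →
    W (addHead (k * a) (map (k *_) xs)) ≈ k ^ length xs * W (addHead a xs)

  W-homogeneous-∷ k xs = derivative-unique
    (derivative-cong (λ a → W-congʰ (+-identityʳ (k * a)) (map (k *_) xs))
                     (λ a → *-congˡ (W-addHead-cong (+-identityʳ (k * a)) (map (k *_) xs)))
      (derivative-∘-affine k 0# (W-derivative (map (k *_) xs))))
    (derivative-scale (k ^ suc (length xs)) (W-derivative xs))
    (λ a → trans (*-congˡ (W-homogeneous-addHead k xs a)) (sym (*-assoc k _ _)))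
    (begin
      W (k * 0# ∷ map (k *_) xs)          ≈⟨ W-congʰ (zeroʳ k) (map (k *_) xs) ⟩
      W (0# ∷ map (k *_) xs)              ≈⟨ W-0∷ (map (k *_) xs) ⟩
      0#                                  ≈⟨ zeroʳ _ ⟨
      k ^ suc (length xs) * 0#            ≈⟨ *-congˡ (W-0∷ xs) ⟨
      k ^ suc (length xs) * W (0# ∷ xs)   ∎)

  W-homogeneous-addHead k []       a = sym (*-identityʳ 1#)
  W-homogeneous-addHead k (x ∷ xs) a = trans
    (W-congʰ (sym (distribˡ k a x)) (map (k *_) xs))
    (W-homogeneous-∷ k xs (a + x))

  -- Monotonicity and mean value inequalities

  nonneg-integrand : ∀ {xs} → All (0# ≤_) xs → All (0# ≤_) (integrand xs)
  nonneg-integrand []           = 0≤1 ∷ []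
  nonneg-integrand (0≤x ∷ 0≤xs) =
    nonneg-translate 0≤x (nonneg-antiderivative (nonneg-integrand 0≤xs))

  W-nonneg : ∀ {xs} → All (0# ≤_) xs → 0# ≤ W xs
  W-nonneg []           = 0≤1
  W-nonneg (0≤x ∷ 0≤xs) = ⟦nonneg⟧ (nonneg-antiderivative (nonneg-integrand 0≤xs)) 0≤x

  W-mono-∷ : ∀ {a b xs} → All (0# ≤_) xs → 0# ≤ a → a ≤ b → W (a ∷ xs) ≤ W (b ∷ xs)
  W-mono-∷ 0≤xs = ⟦⟧-mono-≤ (nonneg-antiderivative (nonneg-integrand 0≤xs))

  W-mono-addHead : ∀ {a b xs} → All (0# ≤_) xs → 0# ≤ a → a ≤ b →
    W (addHead a xs) ≤ W (addHead b xs)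
  W-mono-addHead []           0≤a a≤b = ≤-refl
  W-mono-addHead (0≤x ∷ 0≤xs) 0≤a a≤b =
    W-mono-∷ 0≤xs (+-nonneg 0≤a 0≤x) (+-monoˡ-≤ _ a≤b)

  W′≈ : ∀ xs a → ⟦ antiderivative (integrand xs) ⟧′ a ≈ W (addHead a xs)
  W′≈ xs a = trans (⟦antiderivative⟧′ (integrand xs) a) (⟦integrand⟧ xs a)

  W-lower : ∀ {a h xs} → All (0# ≤_) xs → 0# ≤ a → 0# ≤ h →
    W (a ∷ xs) + h * W (addHead a xs) ≤ W (a + h ∷ xs)
  W-lower {a} {xs = xs} 0≤xs 0≤a 0≤h = ≤-trans
    (≤-reflexive (+-congˡ (*-congˡ (sym (W′≈ xs a)))))
    (⟦⟧′-lower (nonneg-antiderivative (nonneg-integrand 0≤xs)) 0≤a 0≤h)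

  W-upper : ∀ {a h xs} → All (0# ≤_) xs → 0# ≤ a → 0# ≤ h →
    W (a + h ∷ xs) ≤ W (a ∷ xs) + h * W (addHead (a + h) xs)
  W-upper {a} {h} {xs} 0≤xs 0≤a 0≤h = ≤-trans
    (⟦⟧′-upper (nonneg-antiderivative (nonneg-integrand 0≤xs)) 0≤a 0≤h)
    (≤-reflexive (+-congˡ (*-congˡ (W′≈ xs (a + h)))))

  -- Functions that are polynomial in each variable separately

  -- The constructors fix the length of the list independently of `x`, so that functions recursive
  -- in coefficient lists, such as `_⊕_` and `translate`, compute under the binder.
  data PolynomialFamily : (Carrier → List Carrier) → Set (c ⊔ ℓ₁) where
    []  : PolynomialFamily (λ _ → [])
    _∷_ : ∀ {f F} → IsPolynomial f → PolynomialFamily F → PolynomialFamily (λ x → f x ∷ F x)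

  family-const : ∀ p → PolynomialFamily (λ _ → p)
  family-const []      = []
  family-const (a ∷ p) = polynomial-const a ∷ family-const p

  family-⊕ : ∀ {F G} → PolynomialFamily F → PolynomialFamily G → PolynomialFamily (λ x → F x ⊕ G x)
  family-⊕ []      G       = G
  family-⊕ (f ∷ F) []      = f ∷ F
  family-⊕ (f ∷ F) (g ∷ G) = polynomial-+ f g ∷ family-⊕ F G

  family-map* : ∀ {k F} → IsPolynomial k → PolynomialFamily F →
    PolynomialFamily (λ x → map (k x *_) (F x))
  family-map* k []      = []
  family-map* k (f ∷ F) = polynomial-* k f ∷ family-map* k F

  family-translate : ∀ {h F} → IsPolynomial h → PolynomialFamily F →
    PolynomialFamily (λ x → translate (h x) (F x))
  family-translate h []      = []
  family-translate h (f ∷ F) =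
    family-⊕ (f ∷ family-translate h F) (family-map* h (family-translate h F))

  family-antiderivative : ∀ {F} → PolynomialFamily F → PolynomialFamily (λ x → antiderivative (F x))
  family-antiderivative F = polynomial-const 0# ∷ go 0 F
    where
    go : ∀ k {F} → PolynomialFamily F → PolynomialFamily (λ x → divideFrom k (F x))
    go k []      = []
    go k (f ∷ F) = polynomial-* (polynomial-const (reciprocal k)) f ∷ go (suc k) F

  family-⟦⟧ : ∀ {F} → PolynomialFamily F → ∀ a → IsPolynomial (λ x → ⟦ F x ⟧ a)
  family-⟦⟧ []      a = polynomial-const 0#
  family-⟦⟧ (f ∷ F) a = polynomial-+ f (polynomial-* (polynomial-const a) (family-⟦⟧ F a))

  -- Codomain and one-variable predicate are parameters because `W` is made from coefficient lists:
  -- `PolynomialFamily` is carried through `integrand` first, and evaluation then yields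
  -- `IsPolynomial`.
  data Separately {a b} {A : Set a} (P : (Carrier → A) → Set b) :
                  ∀ {n} → (Vec Carrier n → A) → Set (c ⊔ a ⊔ b) where
    nullary : ∀ {f : Vec Carrier 0 → A} → Separately P f
    step    : ∀ {n} {f : Vec Carrier (suc n) → A} →
      (∀ xs → P (λ x → f (x ∷ xs))) →
      (∀ x → Separately P (λ xs → f (x ∷ xs))) → Separately P f

  separately-map : ∀ {a b a′ b′} {A : Set a} {A′ : Set a′}
    {P : (Carrier → A) → Set b} {P′ : (Carrier → A′) → Set b′} (g : A → A′) →
    (∀ {f} → P f → P′ (λ x → g (f x))) →
    ∀ {n} {f : Vec Carrier n → A} → Separately P f → Separately P′ (λ xs → g (f xs))
  separately-map g pres nullary    = nullary
  separately-map g pres (step f r) =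
    step (λ xs → pres (f xs)) (λ x → separately-map g pres (r x))

  separately-const : ∀ {n} a → Separately IsPolynomial {n} (λ _ → a)
  separately-const {zero}  a = nullary
  separately-const {suc n} a = step (λ _ → polynomial-const a) (λ _ → separately-const a)

  separately-+ : ∀ {n} {f g : Vec Carrier n → Carrier} → Separately IsPolynomial f →
    Separately IsPolynomial g → Separately IsPolynomial (λ xs → f xs + g xs)
  separately-+ nullary    nullary    = nullary
  separately-+ (step f r) (step g s) =
    step (λ xs → polynomial-+ (f xs) (g xs)) (λ x → separately-+ (r x) (s x))

  separately-scale : ∀ k {n} {f : Vec Carrier n → Carrier} → Separately IsPolynomial f →
    Separately IsPolynomial (λ xs → k * f xs)
  separately-scale k = separately-map (k *_) (polynomial-* (polynomial-const k))

  -- One variable at a time: for each positive integer in first place, induction frees all other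
  -- variables; the identity principle then frees the first.
  separately-ext : ∀ {n} {f g : Vec Carrier n → Carrier} →
    Separately IsPolynomial f → Separately IsPolynomial g →
    (∀ (m : Vec ℕ n) → VecAll.All (1 ℕ.≤_) m →
      f (Vec.map (_· 1#) m) ≈ g (Vec.map (_· 1#) m)) →
    ∀ xs → f xs ≈ g xs
  separately-ext nullary    nullary    f≈g []       = f≈g [] VecAll.[]
  separately-ext (step f r) (step g s) f≈g (x ∷ xs) = polynomial-ext (f xs) (g xs)
    (λ k 1≤k → separately-ext (r (k · 1#)) (s (k · 1#))
      (λ m 1≤m → f≈g (k ∷ m) (1≤k VecAll.∷ 1≤m)) xs) x

  separately-integrand : ∀ {n} → Separately PolynomialFamily {n} (λ xs → integrand (toList xs))
  separately-integrand {zero}  = nullary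
  separately-integrand {suc n} = step
    (λ xs → family-translate polynomial-id (family-const (antiderivative (integrand (toList xs)))))
    (λ x → separately-map (λ p → translate x (antiderivative p))
      (λ F → family-translate (polynomial-const x) (family-antiderivative F)) separately-integrand)

  separately-W : ∀ {n} → Separately IsPolynomial {n} (λ xs → W (toList xs))
  separately-W {zero}  = nullary
  separately-W {suc n} = step
    (λ xs → antiderivative (integrand (toList xs)) , λ _ → refl)
    (λ x → separately-map (λ p → ⟦ antiderivative p ⟧ x)
      (λ F → family-⟦⟧ (family-antiderivative F) x) separately-integrand)

  open Volume ℝ

  separately-evalMonomial : ∀ {n} (m : Carrier × Vec ℕ n) → Separately IsPolynomial (evalMonomial m)
  separately-evalMonomial (a , e) = separately-scale a (powers e)
    where
    powers : ∀ {n} (e : Vec ℕ n) →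
      Separately IsPolynomial (λ x → Vec.foldr′ _*_ 1# (Vec.zipWith _^_ x e))
    powers []      = nullary
    powers (k ∷ e) = step
      (λ xs → polynomial-* (polynomial-^ polynomial-id k) (polynomial-const _))
      (λ x → separately-scale (x ^ k) (powers e))

  separately-eval : ∀ {n} (p : Polynomial n) → Separately IsPolynomial (eval p)
  separately-eval []      = separately-const 0#
  separately-eval (m ∷ p) = separately-+ (separately-evalMonomial m) (separately-eval p)

-- Lattice points below prefix bounds and the recursion for their number.

module LatticePoints where
  open import Data.Nat using (_≤_; _<_; _+_)
  open import Data.Nat.Properties using (module ≤-Reasoning)
  open ≡ using (_≢_; refl; trans; cong; cong₂; subst; subst₂)

  module _ {a} {A : Set a} where
    unique-⊆⇒length-≤ : ∀ {xs ys : List A} → Unique xs → (∀ {z} → z ∈ xs → z ∈ ys) →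
      length xs ≤ length ys
    unique-⊆⇒length-≤ {[]}     []          _     = z≤n
    unique-⊆⇒length-≤ {x ∷ xs} (x∉xs ∷ uq) xs⊆ys with ∈-∃++ (xs⊆ys (here refl))
    ... | as , bs , refl = begin
      suc (length xs)               ≤⟨ s≤s (unique-⊆⇒length-≤ uq xs⊆as++bs) ⟩
      suc (length (as ++ bs))       ≡⟨ cong suc (length-++ as) ⟩
      suc (length as + length bs)   ≡⟨ ℕ.+-suc (length as) (length bs) ⟨
      length as + suc (length bs)   ≡⟨ length-++ as ⟨
      length (as ++ x ∷ bs)         ∎
      where
      open ≤-Reasoning
      xs⊆as++bs : ∀ {z} → z ∈ xs → z ∈ as ++ bs
      xs⊆as++bs z∈xs with ∈-++⁻ as (xs⊆ys (there z∈xs))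
      ... | inj₁ z∈as         = ∈-++⁺ˡ z∈as
      ... | inj₂ (here refl)  = contradiction refl (All.lookup x∉xs z∈xs)
      ... | inj₂ (there z∈bs) = ∈-++⁺ʳ as z∈bs

  sucHead : ∀ {n} → Vec ℕ (suc n) → Vec ℕ (suc n)
  sucHead (k ∷ ks) = suc k ∷ ks

  -- points (x₂ ∷ … ∷ xₙ ∷ []) y lists the k ∈ ℕⁿ with k₁ + ⋯ + kᵢ < y + x₂ + ⋯ + xᵢ for all i;
  -- tails xs (y - k₁) lists the possible continuations of k₁.
  points : ∀ {n} → Vec ℕ n → ℕ → List (Vec ℕ (suc n))
  tails  : ∀ {n} → Vec ℕ n → ℕ → List (Vec ℕ n)
  points xs zero    = []
  points xs (suc y) = map (0 ∷_) (tails xs (suc y)) ++ map sucHead (points xs y)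
  tails []       y = [] ∷ []
  tails (x ∷ xs) y = points xs (y + x)

  -- Discrete counterpart of `W-derivative`: the increment in `y` is the count one dimension lower,
  -- taken at the right end `suc y` of the unit interval.
  length-points : ∀ {n} (xs : Vec ℕ n) y →
    length (points xs (suc y)) ≡ length (tails xs (suc y)) + length (points xs y)
  length-points xs y = trans (length-++ (map (0 ∷_) (tails xs (suc y))))
    (cong₂ _+_ (length-map (0 ∷_) (tails xs (suc y))) (length-map sucHead (points xs y)))

  points-unique : ∀ {n} (xs : Vec ℕ n) y → Unique (points xs y)
  tails-unique  : ∀ {n} (xs : Vec ℕ n) y → Unique (tails xs y)
  points-unique xs zero    = []
  points-unique xs (suc y) = Unique.++⁺
    (Unique.map⁺ Vec.∷-injectiveʳ (tails-unique xs (suc y)))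
    (Unique.map⁺ sucHead-injective (points-unique xs y))
    disjoint
    where
    sucHead-injective : ∀ {n} {k l : Vec ℕ (suc n)} → sucHead k ≡ sucHead l → k ≡ l
    sucHead-injective {k = _ ∷ _} {_ ∷ _} refl = refl
    0∷≢sucHead : ∀ {n} {k : Vec ℕ n} l → 0 ∷ k ≢ sucHead l
    0∷≢sucHead (_ ∷ _) ()
    disjoint : ∀ {k} → k ∈ map (0 ∷_) (tails xs (suc y)) × k ∈ map sucHead (points xs y) → ⊥
    disjoint (k∈ , k∈′) with ∈-map⁻ (0 ∷_) k∈ | ∈-map⁻ sucHead k∈′
    ... | _ , _ , refl | l , _ , eq = 0∷≢sucHead l eq
  tails-unique []       y = [] ∷ []
  tails-unique (x ∷ xs) y = points-unique xs (y + x)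

  -- Strictness in the first coordinate is carried by writing the bound as `k + suc t`; the slack
  -- `suc t` is handed on to the next coordinate.
  ∈-points⁺ : ∀ {n} (xs : Vec ℕ n) k {t ks} → ks ∈ tails xs (suc t) → (k ∷ ks) ∈ points xs (k + suc t)
  ∈-points⁺ xs zero    {t} ks∈ = ∈-++⁺ˡ (∈-map⁺ (0 ∷_) ks∈)
  ∈-points⁺ xs (suc k) {t} ks∈ =
    ∈-++⁺ʳ (map (0 ∷_) (tails xs (suc (k + suc t)))) (∈-map⁺ sucHead (∈-points⁺ xs k ks∈))

  ∈-points⁻ : ∀ {n} (xs : Vec ℕ n) y {k ks} → (k ∷ ks) ∈ points xs y →
    ∃[ t ] y ≡ k + suc t × ks ∈ tails xs (suc t)
  ∈-points⁻ xs (suc y) {k} {ks} k∈ with ∈-++⁻ (map (0 ∷_) (tails xs (suc y))) k∈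
  ... | inj₁ k∈ˡ with ∈-map⁻ (0 ∷_) k∈ˡ
  ...   | _ , ks∈ , refl = y , refl , ks∈
  ∈-points⁻ xs (suc y) {k} {ks} k∈ | inj₂ k∈ʳ with ∈-map⁻ sucHead k∈ʳ
  ...   | (l ∷ ls) , l∈ , refl with ∈-points⁻ xs y l∈
  ...     | t , eq , ls∈ = t , cong suc eq , ls∈

  prefixSums<⇒∈-points : ∀ {n} (xs : Vec ℕ n) y (k : Vec ℕ (suc n)) →
    (∀ {i} (i≤n : i ≤ suc n) → 1 ≤ i → Vec.sum (truncate i≤n k) < Vec.sum (truncate i≤n (y ∷ xs))) →
    k ∈ points xs y
  prefixSums<⇒∈-points xs y (k ∷ ks) k<
    -- The prefix of length one, whose sum ends in `+ 0`, provides the slack.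
    with ℕ.m≤n⇒∃[o]m+o≡n (subst₂ _<_ (ℕ.+-identityʳ k) (ℕ.+-identityʳ y) (k< (s≤s z≤n) (s≤s z≤n)))
  ... | t , refl = subst (λ m → (k ∷ ks) ∈ points xs m) (ℕ.+-suc k t) (∈-points⁺ xs k (∈-tails xs ks k<))
    where
    ∈-tails : ∀ {n} (xs : Vec ℕ n) (ks : Vec ℕ n) →
      (∀ {i} (i≤n : i ≤ suc n) → 1 ≤ i →
        Vec.sum (truncate i≤n (k ∷ ks)) < Vec.sum (truncate i≤n (suc (k + t) ∷ xs))) →
      ks ∈ tails xs (suc t)
    ∈-tails []       [] _  = here refl
    ∈-tails (x ∷ xs) ks k< = prefixSums<⇒∈-points xs (suc t + x) ks ks<
      where
      ks< : ∀ {i} (i≤n : i ≤ _) → 1 ≤ i →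
        Vec.sum (truncate i≤n ks) < Vec.sum (truncate i≤n (suc t + x ∷ xs))
      ks< {suc i} (s≤s i≤n) _ = ℕ.+-cancelˡ-< k _ _ (begin-strict
        k + Vec.sum (truncate (s≤s i≤n) ks)                <⟨ k< (s≤s (s≤s i≤n)) (s≤s z≤n) ⟩
        suc (k + t) + (x + Vec.sum (truncate i≤n xs))      ≡⟨ cong (_+ (x + Vec.sum (truncate i≤n xs))) (ℕ.+-suc k t) ⟨
        (k + suc t) + (x + Vec.sum (truncate i≤n xs))      ≡⟨ ℕ.+-assoc k (suc t) _ ⟩
        k + (suc t + (x + Vec.sum (truncate i≤n xs)))      ≡⟨ cong (k +_) (ℕ.+-assoc (suc t) x _) ⟨
        k + (suc t + x + Vec.sum (truncate i≤n xs))        ∎)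
        where open ≤-Reasoning

  -- The weak form also covers the empty prefix, where the induction ends, and it matches the closed
  -- inequalities defining `Π`.
  ∈-points⇒prefixSums≤ : ∀ {n} (xs : Vec ℕ n) y {k} → k ∈ points xs y →
    ∀ {i} (i≤n : i ≤ suc n) → Vec.sum (truncate i≤n k) ≤ Vec.sum (truncate i≤n (y ∷ xs))
  ∈-points⇒prefixSums≤ xs y          _  {zero}  _         = z≤n
  ∈-points⇒prefixSums≤ xs y {k ∷ ks} k∈ {suc i} (s≤s i≤n) with ∈-points⁻ xs y k∈
  ... | t , refl , ks∈ = begin
    k + Vec.sum (truncate i≤n ks)                 ≤⟨ ℕ.+-monoʳ-≤ k (tail≤ xs ks∈ i≤n) ⟩
    k + (suc t + Vec.sum (truncate i≤n xs))       ≡⟨ ℕ.+-assoc k (suc t) _ ⟨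
    k + suc t + Vec.sum (truncate i≤n xs)         ∎
    where
    open ≤-Reasoning
    tail≤ : ∀ {n} (xs : Vec ℕ n) {ks} → ks ∈ tails xs (suc t) → ∀ {i} (i≤n : i ≤ n) →
      Vec.sum (truncate i≤n ks) ≤ suc t + Vec.sum (truncate i≤n xs)
    tail≤ xs       _   {zero}  _         = z≤n
    tail≤ (x ∷ xs) {ks} ks∈ {suc i} (s≤s i≤n) = begin
      Vec.sum (truncate (s≤s i≤n) ks)               ≤⟨ ∈-points⇒prefixSums≤ xs (suc t + x) ks∈ (s≤s i≤n) ⟩
      suc t + x + Vec.sum (truncate i≤n xs)         ≡⟨ ℕ.+-assoc (suc t) x _ ⟩
      suc t + (x + Vec.sum (truncate i≤n xs))       ∎

-- Comparison of `W` with the volume of `Π` at integer points.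

module VolumeOfΠ {c ℓ₁ ℓ₂ ℓ₃} (ℝ : RealNumbers c ℓ₁ ℓ₂ ℓ₃) where
  open import Data.Integer as ℤ using (ℤ; +_; -[1+_])
  import Data.Integer.Properties as ℤ
  open LatticePoints
  open RealNumbers ℝ
  open OrderedField ℝ
  open UnivariatePolynomials ℝ
  open VolumeFunction ℝ
  open Volume ℝ
  open CommutativeRing commutativeRing using (ring; commutativeSemiring)
  open import Algebra.Properties.Ring ring using (-‿anti-homo-+)
  open import Algebra.Properties.Semiring.Mult semiring hiding (_×_)
  open import Algebra.Solver.Ring.NaturalCoefficients.Default commutativeSemiring
    using (solve; _:=_; _:+_; _:*_; con)
  open ≤-Reasoning

  real : ∀ {n} → Vec ℕ n → Point n
  real = Vec.map (_· 1#)

  real-nonneg : ∀ {n} (xs : Vec ℕ n) → All (0# ≤_) (toList (real xs))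
  real-nonneg []       = []
  real-nonneg (x ∷ xs) = 0≤n·1 x ∷ real-nonneg xs

  suc·1 : ∀ n → suc n · 1# ≈ n · 1# + 1#
  suc·1 n = +-comm 1# (n · 1#)

  -- The count sums an increasing integrand at the right ends of unit intervals and so dominates the
  -- integral: this is `W-upper` with step one, once per unit of `y`.
  W≤length-points : ∀ {n} (xs : Vec ℕ n) y →
    W (toList (real (y ∷ xs))) ≤ length (points xs y) · 1#
  W≤length-tails : ∀ {n} (xs : Vec ℕ n) y →
    W (addHead (y · 1#) (toList (real xs))) ≤ length (tails xs y) · 1#
  W≤length-points xs zero    = ≤-reflexive (W-0∷ (toList (real xs)))
  W≤length-points xs (suc y) = begin
    W (suc y · 1# ∷ rs)
      ≈⟨ W-congʰ (suc·1 y) rs ⟩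
    W (y · 1# + 1# ∷ rs)
      ≤⟨ W-upper (real-nonneg xs) (0≤n·1 y) 0≤1 ⟩
    W (y · 1# ∷ rs) + 1# * W (addHead (y · 1# + 1#) rs)
      ≈⟨ +-congˡ (trans (*-identityˡ _) (W-addHead-cong (sym (suc·1 y)) rs)) ⟩
    W (y · 1# ∷ rs) + W (addHead (suc y · 1#) rs)
      ≤⟨ +-mono-≤ (W≤length-points xs y) (W≤length-tails xs (suc y)) ⟩
    length (points xs y) · 1# + length (tails xs (suc y)) · 1#
      ≈⟨ +-comm _ _ ⟩
    length (tails xs (suc y)) · 1# + length (points xs y) · 1#
      ≈⟨ ×-homo-+ 1# (length (tails xs (suc y))) (length (points xs y)) ⟨
    (length (tails xs (suc y)) ℕ.+ length (points xs y)) · 1#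
      ≡⟨ ≡.cong (_· 1#) (length-points xs y) ⟨
    length (points xs (suc y)) · 1# ∎
    where rs = toList (real xs)
  W≤length-tails []       y = ≤-reflexive (sym (+-identityʳ 1#))
  W≤length-tails (x ∷ xs) y = ≤-trans
    (≤-reflexive (W-congʰ (sym (×-homo-+ 1# y x)) (toList (real xs))))
    (W≤length-points xs (y ℕ.+ x))

  -- The same sum is at most the integral over the interval moved one unit to the right. Each
  -- coordinate costs one such unit, whence the shift by `suc n` in dimension `suc n`.
  length-points≤W : ∀ {n} (xs : Vec ℕ n) y →
    length (points xs y) · 1# ≤ W ((y ℕ.+ suc n) · 1# ∷ toList (real xs))
  length-tails≤W : ∀ {n} (xs : Vec ℕ n) y →
    length (tails xs (suc y)) · 1# ≤ W (addHead ((y ℕ.+ suc n) · 1#) (toList (real xs)))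
  length-points≤W {n} xs zero    = W-nonneg (0≤n·1 (suc n) ∷ real-nonneg xs)
  length-points≤W {n} xs (suc y) = begin
    length (points xs (suc y)) · 1#
      ≡⟨ ≡.cong (_· 1#) (length-points xs y) ⟩
    (length (tails xs (suc y)) ℕ.+ length (points xs y)) · 1#
      ≈⟨ ×-homo-+ 1# (length (tails xs (suc y))) (length (points xs y)) ⟩
    length (tails xs (suc y)) · 1# + length (points xs y) · 1#
      ≤⟨ +-mono-≤ (length-tails≤W xs y) (length-points≤W xs y) ⟩
    W (addHead (m · 1#) rs) + W (m · 1# ∷ rs)
      ≈⟨ trans (+-comm _ _) (+-congˡ (sym (*-identityˡ _))) ⟩
    W (m · 1# ∷ rs) + 1# * W (addHead (m · 1#) rs)
      ≤⟨ W-lower (real-nonneg xs) (0≤n·1 m) 0≤1 ⟩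
    W (m · 1# + 1# ∷ rs)
      ≈⟨ W-congʰ (sym (suc·1 m)) rs ⟩
    W ((suc y ℕ.+ suc n) · 1# ∷ rs) ∎
    where
    rs = toList (real xs)
    m  = y ℕ.+ suc n
  length-tails≤W []       y = ≤-reflexive (+-identityʳ 1#)
  length-tails≤W {suc n} (x ∷ xs) y = ≤-trans (length-points≤W xs (suc y ℕ.+ x))
    (≤-reflexive (W-congʰ (trans (reflexive (≡.cong (_· 1#) eq)) (×-homo-+ 1# (y ℕ.+ suc (suc n)) x))
      (toList (real xs))))
    where
    eq : suc y ℕ.+ x ℕ.+ suc n ≡ (y ℕ.+ suc (suc n)) ℕ.+ x
    eq = ≡.trans (≡.cong (ℕ._+ suc n) (≡.cong suc (ℕ.+-comm y x)))
      (≡.trans (≡.cong suc (ℕ.+-assoc x y (suc n)))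
        (≡.trans (≡.cong suc (ℕ.+-comm x (y ℕ.+ suc n)))
          (≡.cong (ℕ._+ x) (≡.sym (ℕ.+-suc y (suc n))))))

  -- Grid cubes and lattice points

  integral : ∀ {n} → Vec ℕ n → Vec ℤ n
  integral = Vec.map (λ k → + k)

  integral-injective : ∀ {n} {k l : Vec ℕ n} → integral k ≡ integral l → k ≡ l
  integral-injective {k = []}    {[]}    _  = ≡.refl
  integral-injective {k = k ∷ _} {l ∷ _} eq with Vec.∷-injective eq
  ... | k≡l , ks≡ls = ≡.cong₂ _∷_ (ℤ.+-injective k≡l) (integral-injective ks≡ls)

  fromℤ-suc : ∀ k → fromℤ (ℤ.suc k) ≈ 1# + fromℤ k
  fromℤ-suc (+ n)          = refl
  fromℤ-suc -[1+ zero ]    = sym (trans (+-congˡ (-‿cong (+-identityʳ 1#))) (-‿inverseʳ 1#))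
  fromℤ-suc -[1+ suc n ] = sym (begin-equality
    1# + - (1# + m)       ≈⟨ +-congˡ (-‿anti-homo-+ 1# m) ⟩
    1# + (- m + - 1#)     ≈⟨ solve 3 (λ o a b → o :+ (a :+ b) := a :+ (o :+ b)) refl 1# (- m) (- 1#) ⟩
    - m + (1# + - 1#)     ≈⟨ +-congˡ (-‿inverseʳ 1#) ⟩
    - m + 0#              ≈⟨ +-identityʳ (- m) ⟩
    - m                   ∎)
    where m = suc n · 1#

  fromℤ≤fromℤ-suc : ∀ k → fromℤ k ≤ fromℤ (ℤ.suc k)
  fromℤ≤fromℤ-suc k = ≤-trans (x≤x+y 0≤1)
    (≤-reflexive (trans (+-comm _ 1#) (sym (fromℤ-suc k))))

  fromℤ-neg : ∀ n → fromℤ -[1+ n ] < 0#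
  fromℤ-neg n = begin-strict
    - m            ≈⟨ +-identityˡ (- m) ⟨
    0# + - m       <⟨ +-monoˡ-< (- m) (0<suc[n]·1 n) ⟩
    m + - m        ≈⟨ -‿inverseʳ m ⟩
    0#             ∎
    where m = suc n · 1#

  ^-·1 : ∀ N n → (N ℕ.^ n) · 1# ≈ (N · 1#) ^ n
  ^-·1 N zero    = +-identityʳ 1#
  ^-·1 N (suc n) = trans (×1-homo-* N (N ℕ.^ n)) (*-congˡ (^-·1 N n))

  ^-pos : ∀ {x} → 0# < x → ∀ n → 0# < x ^ n
  ^-pos 0<x zero    = 0<1
  ^-pos 0<x (suc n) = *-pos 0<x (^-pos 0<x n)

  ·-total-real : ∀ N {n} (xs : Vec ℕ n) {i} (i≤n : i ℕ.≤ n) →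
    N · 1# * total (truncate i≤n (real xs)) ≈ Vec.sum (truncate i≤n (Vec.map (N ℕ.*_) xs)) · 1#
  ·-total-real N xs       {zero}  _         = zeroʳ _
  ·-total-real N (x ∷ xs) {suc i} (s≤s i≤n) = begin-equality
    N · 1# * (x · 1# + total (truncate i≤n (real xs)))
      ≈⟨ distribˡ _ _ _ ⟩
    N · 1# * x · 1# + N · 1# * total (truncate i≤n (real xs))
      ≈⟨ +-cong (sym (×1-homo-* N x)) (·-total-real N xs i≤n) ⟩
    (N ℕ.* x) · 1# + Vec.sum (truncate i≤n (Vec.map (N ℕ.*_) xs)) · 1#
      ≈⟨ ×-homo-+ 1# (N ℕ.* x) _ ⟨
    (N ℕ.* x ℕ.+ Vec.sum (truncate i≤n (Vec.map (N ℕ.*_) xs))) · 1# ∎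

  -- Strictness comes from the first coordinate, so the prefix must be nonempty. It turns a closed
  -- bound on the upper corner of a cube into a strict bound on its index.
  sum-truncate-suc : ∀ {n} (k : Vec ℕ n) {i} (i≤n : i ℕ.≤ n) → 1 ℕ.≤ i →
    Vec.sum (truncate i≤n k) ℕ.< Vec.sum (truncate i≤n (Vec.map suc k))
  sum-truncate-suc (k ∷ ks) {suc i} (s≤s i≤n) _ = s≤s (ℕ.+-monoʳ-≤ k (weak ks i≤n))
    where
    weak : ∀ {n} (k : Vec ℕ n) {i} (i≤n : i ℕ.≤ n) →
      Vec.sum (truncate i≤n k) ℕ.≤ Vec.sum (truncate i≤n (Vec.map suc k))
    weak k        {zero}  _         = z≤n
    weak (k ∷ ks) {suc i} (s≤s i≤n) = ℕ.+-mono-≤ (ℕ.n≤1+n k) (weak ks i≤n)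

  module Grid (N : ℕ) (1≤N : 1 ℕ.≤ N) where
    0<N : 0# < N · 1#
    0<N = 0<n·1 1≤N

    1/N : Carrier
    1/N = proj₁ (inverse 0<N)

    0<1/N : 0# < 1/N
    0<1/N = proj₂ (proj₂ (inverse 0<N))

    N*[1/N*x]≈x : ∀ x → N · 1# * (1/N * x) ≈ x
    N*[1/N*x]≈x x = trans (sym (*-assoc _ _ x)) (trans
      (*-congʳ (trans (*-comm _ _) (proj₁ (proj₂ (inverse 0<N))))) (*-identityˡ x))

    N·[1/N*x]≈x : ∀ x → N · (1/N * x) ≈ x
    N·[1/N*x]≈x x = trans (·≈* N _) (N*[1/N*x]≈x x)

    -- Defined for integer indices because an inner list might a priori contain negative ones. For
    -- natural indices, `scaled k` and `scaled (Vec.map suc k)` are opposite corners of the cube.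
    lowerCorner : ∀ {n} → Vec ℤ n → Point n
    lowerCorner = Vec.map (λ k → 1/N * fromℤ k)

    scaled : ∀ {n} → Vec ℕ n → Point n
    scaled = Vec.map (λ k → 1/N * k · 1#)

    lowerCorner∈Cube : ∀ {n} (k : Vec ℤ n) → Cube N k (lowerCorner k)
    lowerCorner∈Cube []       = []
    lowerCorner∈Cube (k ∷ ks) =
      (≤-reflexive (sym (N·[1/N*x]≈x _)) , ≤-trans (≤-reflexive (N·[1/N*x]≈x _)) (fromℤ≤fromℤ-suc k))
      ∷ lowerCorner∈Cube ks

    scaled∈Cube : ∀ {n} (k : Vec ℕ n) → Cube N (integral k) (scaled k)
    scaled∈Cube []       = []
    scaled∈Cube (k ∷ ks) =
      (≤-reflexive (sym (N·[1/N*x]≈x _)) ,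
       ≤-trans (≤-reflexive (N·[1/N*x]≈x _)) (fromℤ≤fromℤ-suc (+ k)))
      ∷ scaled∈Cube ks

    scaled-suc∈Cube : ∀ {n} (k : Vec ℕ n) → Cube N (integral k) (scaled (Vec.map suc k))
    scaled-suc∈Cube []       = []
    scaled-suc∈Cube (k ∷ ks) =
      (≤-trans (fromℤ≤fromℤ-suc (+ k)) (≤-reflexive (sym (N·[1/N*x]≈x _))) ,
       ≤-reflexive (N·[1/N*x]≈x _))
      ∷ scaled-suc∈Cube ks

    nonneg-lowerCorner⇒ℕ : ∀ {n} (k : Vec ℤ n) → VecAll.All (0# ≤_) (lowerCorner k) →
      ∃[ l ] k ≡ integral l
    nonneg-lowerCorner⇒ℕ []              []          = [] , ≡.refl
    nonneg-lowerCorner⇒ℕ (+ m ∷ ks)      (_ ∷ 0≤ks) with nonneg-lowerCorner⇒ℕ ks 0≤ks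
    ... | ls , ≡.refl = m ∷ ls , ≡.refl
    nonneg-lowerCorner⇒ℕ (-[1+ m ] ∷ ks) (0≤k ∷ _)  = contradiction
      (<-respʳ-≈ (zeroʳ 1/N) (*-monoˡ-< 0<1/N (fromℤ-neg m))) 0≤k

    nonneg-scaled : ∀ {n} (k : Vec ℕ n) → VecAll.All (0# ≤_) (scaled k)
    nonneg-scaled []       = []
    nonneg-scaled (k ∷ ks) = *-nonneg (<⇒≤ 0<1/N) (0≤n·1 k) ∷ nonneg-scaled ks

    N*total-scaled : ∀ {n} (k : Vec ℕ n) {i} (i≤n : i ℕ.≤ n) →
      N · 1# * total (truncate i≤n (scaled k)) ≈ Vec.sum (truncate i≤n k) · 1#
    N*total-scaled k        {zero}  _         = zeroʳ _
    N*total-scaled (k ∷ ks) {suc i} (s≤s i≤n) = begin-equality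
      N · 1# * (1/N * k · 1# + total (truncate i≤n (scaled ks)))
        ≈⟨ distribˡ _ _ _ ⟩
      N · 1# * (1/N * k · 1#) + N · 1# * total (truncate i≤n (scaled ks))
        ≈⟨ +-cong (N*[1/N*x]≈x _) (N*total-scaled ks i≤n) ⟩
      k · 1# + Vec.sum (truncate i≤n ks) · 1#
        ≈⟨ ×-homo-+ 1# k _ ⟨
      (k ℕ.+ Vec.sum (truncate i≤n ks)) · 1# ∎

    module _ {n} (y : ℕ) (xs : Vec ℕ n) where
      gridPoints : List (Vec ℕ (suc n))
      gridPoints = points (Vec.map (N ℕ.*_) xs) (N ℕ.* y)

      scaled∈Π : ∀ {k} → k ∈ gridPoints → Π (real (y ∷ xs)) (scaled k)
      scaled∈Π {k} k∈ = nonneg-scaled k , λ i≤n _ → *-cancelˡ-≤ 0<N (begin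
        N · 1# * total (truncate i≤n (scaled k))
          ≈⟨ N*total-scaled k i≤n ⟩
        Vec.sum (truncate i≤n k) · 1#
          ≤⟨ ·1-mono-≤ (∈-points⇒prefixSums≤ (Vec.map (N ℕ.*_) xs) (N ℕ.* y) k∈ i≤n) ⟩
        Vec.sum (truncate i≤n (Vec.map (N ℕ.*_) (y ∷ xs))) · 1#
          ≈⟨ ·-total-real N (y ∷ xs) i≤n ⟨
        N · 1# * total (truncate i≤n (real (y ∷ xs))) ∎)

      scaled-suc∈Π⇒∈gridPoints : ∀ k → Π (real (y ∷ xs)) (scaled (Vec.map suc k)) → k ∈ gridPoints
      scaled-suc∈Π⇒∈gridPoints k (_ , totals≤) = prefixSums<⇒∈-points _ _ k λ i≤n 1≤i →
        ℕ.<-≤-trans (sum-truncate-suc k i≤n 1≤i) (·1-cancel-≤ (begin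
          Vec.sum (truncate i≤n (Vec.map suc k)) · 1#
            ≈⟨ N*total-scaled (Vec.map suc k) i≤n ⟨
          N · 1# * total (truncate i≤n (scaled (Vec.map suc k)))
            ≤⟨ *-monoˡ-≤ (<⇒≤ 0<N) (totals≤ i≤n 1≤i) ⟩
          N · 1# * total (truncate i≤n (real (y ∷ xs)))
            ≈⟨ ·-total-real N (y ∷ xs) i≤n ⟩
          Vec.sum (truncate i≤n (Vec.map (N ℕ.*_) (y ∷ xs))) · 1# ∎))

      -- The lower corner of an inner cube lies in `Π`, which excludes negative indices; the upper
      -- corner lies in `Π`, which makes the index a grid point.
      inner-length≤ : ∀ {inner} → Unique inner →
        (∀ k → k ∈ inner → ∀ z → Cube N k z → Π (real (y ∷ xs)) z) →
        length inner ℕ.≤ length gridPoints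
      inner-length≤ {inner} unique cubes⊆Π = ≡.subst (length inner ℕ.≤_) (length-map integral gridPoints)
        (unique-⊆⇒length-≤ unique inner⊆)
        where
        inner⊆ : ∀ {k} → k ∈ inner → k ∈ List.map integral gridPoints
        inner⊆ {k} k∈ with nonneg-lowerCorner⇒ℕ k
          (proj₁ (cubes⊆Π k k∈ (lowerCorner k) (lowerCorner∈Cube k)))
        ... | l , ≡.refl = ∈-map⁺ integral (scaled-suc∈Π⇒∈gridPoints l
          (cubes⊆Π k k∈ (scaled (Vec.map suc l)) (scaled-suc∈Cube l)))

      -- The cube of a grid point meets `Π` in its lower corner, so its index has to be listed.
      length≤outer : ∀ {outer} →
        (∀ k z → Cube N k z → Π (real (y ∷ xs)) z → k ∈ outer) →
        length gridPoints ℕ.≤ length outer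
      length≤outer {outer} cubes⊆ = ≡.subst (ℕ._≤ length outer) (length-map integral gridPoints)
        (unique-⊆⇒length-≤
          (Unique.map⁺ integral-injective (points-unique (Vec.map (N ℕ.*_) xs) (N ℕ.* y)))
          ⊆outer)
        where
        ⊆outer : ∀ {k} → k ∈ List.map integral gridPoints → k ∈ outer
        ⊆outer k∈ with ∈-map⁻ integral k∈
        ... | l , l∈ , ≡.refl = cubes⊆ (integral l) (scaled l) (scaled∈Cube l) (scaled∈Π l∈)

  -- The volume at lattice points

  module _ {n} (y : ℕ) (xs : Vec ℕ n) where
    private
      rs = toList (real xs)
      V  = W (toList (real (y ∷ xs)))
      -- `h` is the shift lost between sums and integrals; `h * K` bounds the resulting error,
      -- divided by N^n, uniformly in N.
      h  = suc n · 1#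
      K  = W (addHead (y · 1# + h) rs)

    module _ (N : ℕ) (1≤N : 1 ℕ.≤ N) where
      open Grid N 1≤N

      private
        Nxs = Vec.map (N ℕ.*_) xs

      real-scale : ∀ {n} (xs : Vec ℕ n) → ListPointwise.Pointwise _≈_
        (toList (real (Vec.map (N ℕ.*_) xs))) (List.map (N · 1# *_) (toList (real xs)))
      real-scale []       = ListPointwise.[]
      real-scale (x ∷ xs) = ×1-homo-* N x ListPointwise.∷ real-scale xs

      W-scale-∷ : ∀ a → W (N · 1# * a ∷ toList (real Nxs)) ≈ (N · 1#) ^ suc n * W (a ∷ rs)
      W-scale-∷ a = begin-equality
        W (N · 1# * a ∷ toList (real Nxs))                 ≈⟨ W-cong-∷ refl (real-scale xs) ⟩
        W (N · 1# * a ∷ List.map (N · 1# *_) rs)           ≈⟨ W-homogeneous-∷ (N · 1#) rs a ⟩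
        (N · 1#) ^ suc (length rs) * W (a ∷ rs)
          ≡⟨ ≡.cong (λ m → (N · 1#) ^ suc m * W (a ∷ rs)) (Vec.length-toList (real xs)) ⟩
        (N · 1#) ^ suc n * W (a ∷ rs)                      ∎

      W-scale-addHead : ∀ a →
        W (addHead (N · 1# * a) (toList (real Nxs))) ≈ (N · 1#) ^ n * W (addHead a rs)
      W-scale-addHead a = begin-equality
        W (addHead (N · 1# * a) (toList (real Nxs)))             ≈⟨ W-addHead-cong₂ (N · 1# * a) (real-scale xs) ⟩
        W (addHead (N · 1# * a) (List.map (N · 1# *_) rs))       ≈⟨ W-homogeneous-addHead (N · 1#) rs a ⟩
        (N · 1#) ^ length rs * W (addHead a rs)
          ≡⟨ ≡.cong (λ m → (N · 1#) ^ m * W (addHead a rs)) (Vec.length-toList (real xs)) ⟩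
        (N · 1#) ^ n * W (addHead a rs)                          ∎

      gridPoints-lower : (N · 1#) ^ suc n * V ≤ length (gridPoints y xs) · 1#
      gridPoints-lower = begin
        (N · 1#) ^ suc n * V                          ≈⟨ W-scale-∷ (y · 1#) ⟨
        W (N · 1# * y · 1# ∷ toList (real Nxs))       ≈⟨ W-congʰ (×1-homo-* N y) (toList (real Nxs)) ⟨
        W ((N ℕ.* y) · 1# ∷ toList (real Nxs))        ≤⟨ W≤length-points Nxs (N ℕ.* y) ⟩
        length (gridPoints y xs) · 1#                 ∎

      gridPoints-upper : length (gridPoints y xs) · 1# ≤ (N · 1#) ^ n * (N · 1# * V + h * K)
      gridPoints-upper = begin
        length (gridPoints y xs) · 1#
          ≤⟨ length-points≤W Nxs (N ℕ.* y) ⟩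
        W ((N ℕ.* y ℕ.+ suc n) · 1# ∷ toList (real Nxs))
          ≈⟨ W-congʰ (trans (×-homo-+ 1# (N ℕ.* y) (suc n)) (+-congʳ (×1-homo-* N y))) (toList (real Nxs)) ⟩
        W (N · 1# * y · 1# + h ∷ toList (real Nxs))
          ≤⟨ W-upper (real-nonneg Nxs) 0≤Ny (0≤n·1 (suc n)) ⟩
        W (N · 1# * y · 1# ∷ toList (real Nxs)) + h * W (addHead (N · 1# * y · 1# + h) (toList (real Nxs)))
          -- Since `1 ≤ N`, the shift `h` may be enlarged to `N · 1# * h`; then `N` factors out of
          -- the head and homogeneity applies.
          ≤⟨ +-monoʳ-≤ _ (*-monoˡ-≤ (0≤n·1 (suc n)) (W-mono-addHead (real-nonneg Nxs) (+-nonneg 0≤Ny (0≤n·1 (suc n)))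
               (≤-trans (+-monoʳ-≤ _ h≤Nh) (≤-reflexive (sym (distribˡ _ _ _)))))) ⟩
        W (N · 1# * y · 1# ∷ toList (real Nxs)) + h * W (addHead (N · 1# * (y · 1# + h)) (toList (real Nxs)))
          ≈⟨ +-cong (W-scale-∷ (y · 1#)) (*-congˡ (W-scale-addHead (y · 1# + h))) ⟩
        (N · 1#) ^ suc n * V + h * ((N · 1#) ^ n * K)
          ≈⟨ solve 5 (λ N e V h K → N :* e :* V :+ h :* (e :* K) := e :* (N :* V :+ h :* K))
               refl (N · 1#) ((N · 1#) ^ n) V h K ⟩
        (N · 1#) ^ n * (N · 1# * V + h * K) ∎
        where
        0≤Ny : 0# ≤ N · 1# * y · 1#
        0≤Ny = *-nonneg (0≤n·1 N) (0≤n·1 y)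
        h≤Nh : h ≤ N · 1# * h
        h≤Nh = ≤-trans (·1-mono-≤ (ℕ.m≤n*m (suc n) N {{ℕ.>-nonZero 1≤N}}))
          (≤-reflexive (×1-homo-* N (suc n)))

    module _ (N : ℕ) (1≤N : 1 ℕ.≤ N) where
      open Grid N 1≤N

      outer-bound : ∀ {outer v} →
        (∀ k z → Cube N k z → Π (real (y ∷ xs)) z → k ∈ outer) →
        length outer · 1# < (N ℕ.^ suc n) · v → V < v
      outer-bound {outer} {v} meets outer< = *-cancelˡ-< (^-pos 0<N (suc n)) (begin-strict
        (N · 1#) ^ suc n * V                ≤⟨ gridPoints-lower N 1≤N ⟩
        length (gridPoints y xs) · 1#       ≤⟨ ·1-mono-≤ (length≤outer y xs meets) ⟩
        length outer · 1#                   <⟨ outer< ⟩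
        (N ℕ.^ suc n) · v                   ≈⟨ ·≈* (N ℕ.^ suc n) v ⟩
        (N ℕ.^ suc n) · 1# * v              ≈⟨ *-congʳ (^-·1 N (suc n)) ⟩
        (N · 1#) ^ suc n * v                ∎)

      inner-bound : ∀ {inner v} → Unique inner →
        (∀ k → k ∈ inner → ∀ z → Cube N k z → Π (real (y ∷ xs)) z) →
        (N ℕ.^ suc n) · v < length inner · 1# → N · 1# * v < N · 1# * V + h * K
      inner-bound {inner} {v} unique inside <inner = *-cancelˡ-< (^-pos 0<N n) (begin-strict
        (N · 1#) ^ n * (N · 1# * v)
          ≈⟨ solve 3 (λ e N v → e :* (N :* v) := N :* e :* v) refl ((N · 1#) ^ n) (N · 1#) v ⟩
        (N · 1#) ^ suc n * v                           ≈⟨ *-congʳ (^-·1 N (suc n)) ⟨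
        (N ℕ.^ suc n) · 1# * v                         ≈⟨ ·≈* (N ℕ.^ suc n) v ⟨
        (N ℕ.^ suc n) · v                              <⟨ <inner ⟩
        length inner · 1#                              ≤⟨ ·1-mono-≤ (inner-length≤ y xs unique inside) ⟩
        length (gridPoints y xs) · 1#                  ≤⟨ gridPoints-upper N 1≤N ⟩
        (N · 1#) ^ n * (N · 1# * V + h * K)            ∎)

    V≤volume : ∀ {v} → HasVolume (Π (real (y ∷ xs))) v → V ≤ v
    V≤volume {v} vol v<V =
      -- With ε = V - v the outer bound reads `V < v + (V - v)`, that is, `V < V`.
      let N₀ , approx = vol (V - v) (x<y⇒0<y-x v<V)
          _ , _ , _ , _ , meets , _ , outer< = approx (suc N₀) (ℕ.n≤1+n N₀) (s≤s z≤n)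
      in <-irrefl (sym (trans (+-comm v (V - v)) ([x-y]+y≈x V v)))
           (outer-bound (suc N₀) (s≤s z≤n) meets outer<)

    -- If `V < v`, let ε be half the gap, so that `v - ε` equals `V + ε` and the inner bound becomes
    -- N ε < h K. The right side does not depend on N, against the Archimedean property.
    volume≤V : ∀ {v} → HasVolume (Π (real (y ∷ xs))) v → v ≤ V
    volume≤V {v} vol V<v =
      let ε⁻¹ , ε⁻¹*ε≈1 , 0<ε⁻¹ = inverse 0<ε
          M , <M = archimedean (ε⁻¹ * (h * K))
          N₀ , approx = vol ε 0<ε
          N = suc (M ℕ.+ N₀)
          _ , _ , unique , inside , _ , <inner , _ =
            approx N (ℕ.m≤n⇒m≤1+n (ℕ.m≤n+m N₀ M)) (s≤s z≤n)
      in <-irrefl refl (begin-strict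
        N · 1#                  ≈⟨ trans (*-congʳ ε⁻¹*ε≈1) (*-identityˡ _) ⟨
        ε⁻¹ * ε * N · 1#        ≈⟨ solve 3 (λ i e N → i :* e :* N := i :* (N :* e)) refl ε⁻¹ ε (N · 1#) ⟩
        ε⁻¹ * (N · 1# * ε)      <⟨ *-monoˡ-< 0<ε⁻¹ (Nε<hK N (inner-bound N (s≤s z≤n) unique inside <inner)) ⟩
        ε⁻¹ * (h * K)           <⟨ <M ⟩
        M · 1#                  ≤⟨ ·1-mono-≤ (ℕ.m≤n⇒m≤1+n (ℕ.m≤m+n M N₀)) ⟩
        N · 1#                  ∎)
      where
      ½ = reciprocal 1
      ε = ½ * (v - V)
      0<ε : 0# < ε
      0<ε = *-pos (0<reciprocal 1) (x<y⇒0<y-x V<v)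
      v-ε≈V+ε : v - ε ≈ V + ε
      v-ε≈V+ε = begin-equality
        v - ε                     ≈⟨ +-congʳ (sym V+ε+ε≈v) ⟩
        ((V + ε) + ε) - ε         ≈⟨ +-assoc (V + ε) ε (- ε) ⟩
        (V + ε) + (ε - ε)         ≈⟨ trans (+-congˡ (-‿inverseʳ ε)) (+-identityʳ _) ⟩
        V + ε                     ∎
        where
        V+ε+ε≈v : (V + ε) + ε ≈ v
        V+ε+ε≈v = begin-equality
          (V + ε) + ε
            ≈⟨ solve 3 (λ V r d → (V :+ r :* d) :+ r :* d := r :* (con 1 :+ (con 1 :+ con 0)) :* d :+ V)
                 refl V ½ (v - V) ⟩
          ½ * (2 · 1#) * (v - V) + V
            ≈⟨ +-congʳ (trans (*-congʳ (reciprocal-inverseˡ 1)) (*-identityˡ _)) ⟩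
          (v - V) + V               ≈⟨ [x-y]+y≈x v V ⟩
          v                         ∎
      Nε<hK : ∀ N → N · 1# * (v - ε) < N · 1# * V + h * K → N · 1# * ε < h * K
      Nε<hK N N[v-ε]< = +-cancelˡ-< (N · 1# * V) (begin-strict
        N · 1# * V + N · 1# * ε       ≈⟨ distribˡ (N · 1#) V ε ⟨
        N · 1# * (V + ε)              ≈⟨ *-congˡ v-ε≈V+ε ⟨
        N · 1# * (v - ε)              <⟨ N[v-ε]< ⟩
        N · 1# * V + h * K            ∎)

  volume≈W : ∀ {n v} (m : Vec ℕ (suc n)) → HasVolume (Π (real m)) v → v ≈ W (toList (real m))
  volume≈W (y ∷ xs) vol = ≤-antisym (volume≤V y xs vol) (V≤volume y xs vol)

  real-positive : ∀ {n} {m : Vec ℕ n} → VecAll.All (1 ℕ.≤_) m → VecAll.All (0# <_) (real m)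
  real-positive []          = []
  real-positive (1≤k ∷ 1≤m) = 0<n·1 1≤k ∷ real-positive 1≤m

  -- The specification thus determines the polynomial: volumes are compared at positive integer
  -- points, and the identity principle in each variable does the rest.
  eval≈W : ∀ {n} {p : Polynomial (suc n)} → IsVolumePolynomial p → ∀ x → eval p x ≈ W (toList x)
  eval≈W {p = p} isVol = separately-ext (separately-eval p) separately-W
    (λ m 1≤m → volume≈W m (IsVolumePolynomial.volume isVol (real m) (real-positive 1≤m)))

-- Identities for binomial coefficients and factorials.

module BinomialCoefficients where
  open import Data.Nat using (_≤_; _<_)

  nCk*k![n∸k]!≡n! : ∀ {n k} → k ≤ n → (n C k) ℕ.* (k ! ℕ.* (n ∸ k) !) ≡ n !
  nCk*k![n∸k]!≡n! {n} {k} k≤n = ≡.trans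
    (≡.cong (ℕ._* (k ! ℕ.* (n ∸ k) !)) (nCk≡n!/k![n-k]! k≤n))
    (m/n*n≡m {{k ℕ.!* (n ∸ k) !≢0}} (k![n∸k]!∣n! k≤n))

  -- Multiplied by `k ! * (n ∸ k) !`, both sides become `(suc n) !`. This is the coefficient
  -- identity behind `abelTerm-derivative`.
  [1+n]Ck*[1+n∸k]≡[1+n]*nCk : ∀ {n k} → k ≤ n →
    (suc n C k) ℕ.* suc (n ∸ k) ≡ suc n ℕ.* (n C k)
  [1+n]Ck*[1+n∸k]≡[1+n]*nCk {n} {k} k≤n =
    ℕ.*-cancelʳ-≡ _ _ (k ! ℕ.* (n ∸ k) !) {{k ℕ.!* (n ∸ k) !≢0}} (begin
      c ℕ.* suc m ℕ.* (k ! ℕ.* m !)         ≡⟨ ℕ.*-assoc c (suc m) _ ⟩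
      c ℕ.* (suc m ℕ.* (k ! ℕ.* m !))       ≡⟨ ≡.cong (c ℕ.*_) (ℕ.*-comm (suc m) _) ⟩
      c ℕ.* (k ! ℕ.* m ! ℕ.* suc m)         ≡⟨ ≡.cong (c ℕ.*_) (ℕ.*-assoc (k !) (m !) (suc m)) ⟩
      c ℕ.* (k ! ℕ.* (m ! ℕ.* suc m))       ≡⟨ ≡.cong (λ z → c ℕ.* (k ! ℕ.* z)) (ℕ.*-comm (m !) (suc m)) ⟩
      c ℕ.* (k ! ℕ.* (suc m) !)             ≡⟨ ≡.cong (λ z → c ℕ.* (k ! ℕ.* z !)) (≡.sym (ℕ.+-∸-assoc 1 k≤n)) ⟩
      c ℕ.* (k ! ℕ.* (suc n ∸ k) !)         ≡⟨ nCk*k![n∸k]!≡n! (ℕ.m≤n⇒m≤1+n k≤n) ⟩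
      suc n ℕ.* n !                         ≡⟨ ≡.cong (suc n ℕ.*_) (≡.sym (nCk*k![n∸k]!≡n! k≤n)) ⟩
      suc n ℕ.* ((n C k) ℕ.* (k ! ℕ.* m !)) ≡⟨ ℕ.*-assoc (suc n) (n C k) _ ⟨
      suc n ℕ.* (n C k) ℕ.* (k ! ℕ.* m !)   ∎)
    where
    open ≡.≡-Reasoning
    c = suc n C k
    m = n ∸ k

  nC0≡1 : ∀ n → n C 0 ≡ 1
  nC0≡1 n = ≡.trans (nCk≡nC[n∸k] {n = n} z≤n) (nCn≡1 n)

  n∸j≡1+[n∸[1+j]] : ∀ {n j} → j < n → n ∸ j ≡ suc (n ∸ suc j)
  n∸j≡1+[n∸[1+j]] (s≤s j≤n) = ℕ.+-∸-assoc 1 j≤n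

-- Abel polynomials, Abel's binomial theorem and closed forms of `W`.

module ClosedForms {c ℓ₁ ℓ₂ ℓ₃} (ℝ : RealNumbers c ℓ₁ ℓ₂ ℓ₃) where
  open BinomialCoefficients
  open RealNumbers ℝ hiding (_≤_; _<_)
  open OrderedField ℝ using (·≈*; [x-y]+y≈x)
  open UnivariatePolynomials ℝ
  open import Data.Nat using (_≤_; _<_)
  open import Algebra.Apartness.Properties.HeytingCommutativeRing
    (HeytingField.heytingCommutativeRing heytingField) using (x-0≈x)
  open VolumeFunction ℝ
  open CommutativeRing commutativeRing using (ring; commutativeSemiring)
  open import Algebra.Properties.Ring ring using (-‿+-comm)
  open import Algebra.Properties.Semiring.Mult semiring hiding (_×_)
  open import Algebra.Properties.Semiring.Exp semiring using (^-congˡ)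
  open import Algebra.Properties.Semiring.Sum semiring using (sum-cong-≋; *-distribˡ-sum; sum-replicate-zero)
  open import Algebra.Solver.Ring.NaturalCoefficients.Default commutativeSemiring
    using (solve; _:=_; _:+_; _:*_; con)
  open import Relation.Binary.Reasoning.Setoid setoid

  sum-cong-< : ∀ n {f g : ℕ → Carrier} → (∀ {j} → j < n → f j ≈ g j) →
    sum {n} (f ∘ toℕ) ≈ sum {n} (g ∘ toℕ)
  sum-cong-< n f≈g = sum-cong-≋ {n} (λ i → f≈g (toℕ<n i))

  sum-last : ∀ n (f : ℕ → Carrier) → sum {suc n} (f ∘ toℕ) ≈ sum {n} (f ∘ toℕ) + f n
  sum-last zero    f = +-comm (f 0) 0#
  sum-last (suc n) f = trans (+-congˡ (sum-last n (f ∘ suc))) (sym (+-assoc _ _ _))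

  derivative-sum : ∀ n {f f′ : Fin n → Carrier → Carrier} →
    (∀ i → HasDerivative (f i) (f′ i)) →
    HasDerivative (λ x → sum (λ i → f i x)) (λ x → sum (λ i → f′ i x))
  derivative-sum zero    d = derivative-const 0#
  derivative-sum (suc n) d = derivative-+ (d Fin.zero) (derivative-sum n (d ∘ Fin.suc))

  -- Abel polynomials

  abel : Carrier → ℕ → Carrier → Carrier
  abel b zero    a = 1#
  abel b (suc k) a = a * (a + suc k · b) ^ k

  abel-0 : ∀ b k → abel b (suc k) 0# ≈ 0#
  abel-0 b k = zeroˡ _

  abel-derivative : ∀ b k →
    HasDerivative (abel b (suc k)) (λ a → suc k · 1# * abel b k (a + b))
  abel-derivative b zero = derivative-cong (λ _ → refl)
    (λ a → solve 1 (λ a → con 1 :* con 1 :+ a :* con 0 := (con 1 :+ con 0) :* con 1) refl a)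
    (derivative-* derivative-id (derivative-const 1#))
  abel-derivative b (suc k) = derivative-cong (λ _ → refl) eq
    (derivative-* derivative-id
      (derivative-^ (derivative-+ derivative-id (derivative-const (suc (suc k) · b))) k))
    where
    eq : ∀ a →
      1# * (a + suc (suc k) · b) ^ suc k
        + a * (suc k · 1# * ((1# + 0#) * (a + suc (suc k) · b) ^ k))
      ≈ suc (suc k) · 1# * ((a + b) * ((a + b) + suc k · b) ^ k)
    eq a = begin
      1# * (L * L ^ k) + a * (suc k · 1# * ((1# + 0#) * L ^ k))
        ≈⟨ solve 4 (λ L e a m → con 1 :* (L :* e) :+ a :* (m :* ((con 1 :+ con 0) :* e))
                             := (L :+ a :* m) :* e) refl L (L ^ k) a (suc k · 1#) ⟩
      (L + a * suc k · 1#) * L ^ k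
        -- With n = k + 2, the bracket is L + (n - 1) a = n (a + b).
        ≈⟨ *-congʳ (trans (+-congʳ (+-congˡ (·≈* (suc (suc k)) b)))
             (solve 3 (λ a b m → (a :+ (con 1 :+ m) :* b) :+ a :* m := (con 1 :+ m) :* (a :+ b))
               refl a b (suc k · 1#))) ⟩
      suc (suc k) · 1# * (a + b) * L ^ k
        ≈⟨ *-assoc _ _ _ ⟩
      suc (suc k) · 1# * ((a + b) * L ^ k)
        ≈⟨ *-congˡ (*-congˡ (^-congˡ k (sym (+-assoc a b (suc k · b))))) ⟩
      suc (suc k) · 1# * ((a + b) * ((a + b) + suc k · b) ^ k) ∎
      where L = a + suc (suc k) · b

  -- The weights `γ` are a parameter free of `a`: differentiation lowers `n` and shifts `a` by `b`,
  -- but keeps the weights and the truncation of the sum. Abel's binomial theorem and the truncated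
  -- sum of the third formula then share one derivative rule.
  abelTerm : (ℕ → Carrier) → Carrier → ℕ → Carrier → ℕ → Carrier
  abelTerm γ b n a j = (n C j) · (γ j * abel b (n ∸ j) a)

  abelSum : (ℕ → Carrier) → Carrier → ℕ → ℕ → Carrier → Carrier
  abelSum γ b n m a = sum {suc m} (abelTerm γ b n a ∘ toℕ)

  abelTerm-overflow : ∀ γ b {n} a {j} → n < j → abelTerm γ b n a j ≈ 0#
  abelTerm-overflow γ b {n} a {j} n<j = reflexive (≡.cong (_· (γ j * abel b (n ∸ j) a)) (k>n⇒nCk≡0 n<j))

  abelTerm-0 : ∀ γ b {n j} → j < n → abelTerm γ b n 0# j ≈ 0#
  abelTerm-0 γ b {n} {j} j<n = begin
    (n C j) · (γ j * abel b (n ∸ j) 0#)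
      ≡⟨ ≡.cong (λ k → (n C j) · (γ j * abel b k 0#)) (n∸j≡1+[n∸[1+j]] j<n) ⟩
    (n C j) · (γ j * abel b (suc (n ∸ suc j)) 0#)
      ≈⟨ ×-congʳ (n C j) (trans (*-congˡ (abel-0 b (n ∸ suc j))) (zeroʳ (γ j))) ⟩
    (n C j) · 0#
      ≈⟨ trans (·≈* (n C j) 0#) (zeroʳ _) ⟩
    0# ∎

  abelTerm-derivative : ∀ γ b n j →
    HasDerivative (λ a → abelTerm γ b (suc n) a j) (λ a → suc n · 1# * abelTerm γ b n (a + b) j)
  abelTerm-derivative γ b n j with j ℕ.≤? n
  -- For `j > n` the term at `suc n` is constant in `a`, as `suc n ∸ j` is zero, and the term at `n`
  -- has binomial coefficient zero.
  ... | no j≰n = derivative-cong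
      (λ a → reflexive (≡.cong (λ k → (suc n C j) · (γ j * abel b k a)) (≡.sym (ℕ.m≤n⇒m∸n≡0 (ℕ.≰⇒> j≰n)))))
      (λ a → sym (trans (*-congˡ (abelTerm-overflow γ b (a + b) (ℕ.≰⇒> j≰n))) (zeroʳ _)))
      (derivative-const ((suc n C j) · (γ j * 1#)))
  ... | yes j≤n = derivative-cong
      (λ a → trans (sym (·≈* (suc n C j) _))
        (reflexive (≡.cong (λ k → (suc n C j) · (γ j * abel b k a)) (≡.sym (ℕ.+-∸-assoc 1 j≤n)))))
      (λ a → eq (abel b (n ∸ j) (a + b)))
      (derivative-scale ((suc n C j) · 1#) (derivative-scale (γ j) (abel-derivative b (n ∸ j))))
    where
    eq : ∀ z → (suc n C j) · 1# * (γ j * (suc (n ∸ j) · 1# * z)) ≈ suc n · 1# * ((n C j) · (γ j * z))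
    eq z = begin
      (suc n C j) · 1# * (γ j * (suc (n ∸ j) · 1# * z))
        ≈⟨ solve 4 (λ c g m z → c :* (g :* (m :* z)) := c :* m :* (g :* z))
             refl ((suc n C j) · 1#) (γ j) (suc (n ∸ j) · 1#) z ⟩
      (suc n C j) · 1# * (suc (n ∸ j) · 1#) * (γ j * z)
        ≈⟨ *-congʳ (×1-homo-* (suc n C j) (suc (n ∸ j))) ⟨
      ((suc n C j) ℕ.* suc (n ∸ j)) · 1# * (γ j * z)
        ≡⟨ ≡.cong (λ m → m · 1# * (γ j * z)) ([1+n]Ck*[1+n∸k]≡[1+n]*nCk j≤n) ⟩
      (suc n ℕ.* (n C j)) · 1# * (γ j * z)
        ≈⟨ *-congʳ (×1-homo-* (suc n) (n C j)) ⟩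
      suc n · 1# * (n C j) · 1# * (γ j * z)
        ≈⟨ *-assoc _ _ _ ⟩
      suc n · 1# * ((n C j) · 1# * (γ j * z))
        ≈⟨ *-congˡ (·≈* (n C j) (γ j * z)) ⟨
      suc n · 1# * ((n C j) · (γ j * z)) ∎

  abelSum-derivative : ∀ γ b n m →
    HasDerivative (abelSum γ b (suc n) m) (λ a → suc n · 1# * abelSum γ b n m (a + b))
  abelSum-derivative γ b n m = derivative-cong (λ _ → refl)
    (λ a → sym (*-distribˡ-sum {suc m} (suc n · 1#) (abelTerm γ b n (a + b) ∘ toℕ)))
    (derivative-sum (suc m) (λ i → abelTerm-derivative γ b n (toℕ i)))

  abelSum-0 : ∀ γ b {n m} → m < n → abelSum γ b n m 0# ≈ 0#
  abelSum-0 γ b {n} {m} m<n = trans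
    (sum-cong-< (suc m) (λ j≤m → abelTerm-0 γ b (ℕ.<-≤-trans j≤m m<n)))
    (sum-replicate-zero (suc m))

  abelSum-congᵞ : ∀ {γ δ} b n m a → (∀ {j} → j ≤ m → γ j ≈ δ j) →
    abelSum γ b n m a ≈ abelSum δ b n m a
  abelSum-congᵞ b n m a γ≈δ = sum-cong-< (suc m)
    (λ {j} j≤m → ×-congʳ (n C j) (*-congʳ {abel b (n ∸ j) a} (γ≈δ (ℕ.s≤s⁻¹ j≤m))))

  x-[b+y]≈[x-b]-y : ∀ x b y → x - (b + y) ≈ (x - b) - y
  x-[b+y]≈[x-b]-y x b y = trans (+-congˡ (sym (-‿+-comm b y))) (sym (+-assoc x (- b) (- y)))

  -- Lowering the degree by one and replacing `c` by `c - b` leaves the weights fixed. As `a` moves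
  -- to `a + b` at the same time, `a + c` is preserved, which closes the induction in
  -- `abel-binomial`.
  abel-shift : ∀ c b m {j} → j ≤ m →
    (c - (suc m ∸ j) · b) ^ j ≈ ((c - b) - (m ∸ j) · b) ^ j
  abel-shift c b m {j} j≤m = ^-congˡ j (trans
    (reflexive (≡.cong (λ k → c - k · b) (ℕ.+-∸-assoc 1 j≤m)))
    (x-[b+y]≈[x-b]-y c b ((m ∸ j) · b)))

  [a+b]+[c-b]≈a+c : ∀ a b c → (a + b) + (c - b) ≈ a + c
  [a+b]+[c-b]≈a+c a b c = trans (+-assoc a b (c - b))
    (+-congˡ (trans (+-comm b (c - b)) ([x-y]+y≈x c b)))

  -- The derivative of either side is `suc n` times the identity for `n` at `a + b` and `c - b`. At
  -- `a = 0#` every Abel polynomial of positive degree vanishes, so only the term `j = suc n`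
  -- remains and gives the power of `c`.
  abel-binomial : ∀ b n c a → abelSum (λ j → (c - (n ∸ j) · b) ^ j) b n n a ≈ (a + c) ^ n
  abel-binomial b zero    c a = solve 0 ((con 1 :* con 1 :+ con 0) :+ con 0 := con 1) refl
  abel-binomial b (suc n) c = derivative-unique
    (abelSum-derivative γ b n (suc n))
    (derivative-^ (derivative-+ derivative-id (derivative-const c)) n)
    (λ a → *-congˡ (begin
      abelSum γ b n (suc n) (a + b)
        ≈⟨ sum-last (suc n) (abelTerm γ b n (a + b)) ⟩
      abelSum γ b n n (a + b) + abelTerm γ b n (a + b) (suc n)
        ≈⟨ trans (+-congˡ (abelTerm-overflow γ b (a + b) (ℕ.n<1+n n))) (+-identityʳ _) ⟩
      abelSum γ b n n (a + b)
        ≈⟨ abelSum-congᵞ b n n (a + b) (abel-shift c b n) ⟩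
      abelSum (λ j → ((c - b) - (n ∸ j) · b) ^ j) b n n (a + b)
        ≈⟨ abel-binomial b n (c - b) (a + b) ⟩
      ((a + b) + (c - b)) ^ n
        ≈⟨ ^-congˡ n ([a+b]+[c-b]≈a+c a b c) ⟩
      (a + c) ^ n
        ≈⟨ solve 1 (λ z → z := (con 1 :+ con 0) :* z) refl ((a + c) ^ n) ⟩
      (1# + 0#) * (a + c) ^ n ∎))
    (begin
      abelSum γ b (suc n) (suc n) 0#
        ≈⟨ sum-last (suc n) (abelTerm γ b (suc n) 0#) ⟩
      abelSum γ b (suc n) n 0# + abelTerm γ b (suc n) 0# (suc n)
        ≈⟨ +-cong (abelSum-0 γ b (ℕ.n<1+n n)) last-term ⟩
      0# + c ^ suc n
        ≈⟨ trans (+-identityˡ _) (^-congˡ (suc n) (sym (+-identityˡ c))) ⟩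
      (0# + c) ^ suc n ∎)
    where
    γ : ℕ → Carrier
    γ j = (c - (suc n ∸ j) · b) ^ j
    last-term : abelTerm γ b (suc n) 0# (suc n) ≈ c ^ suc n
    last-term = begin
      (suc n C suc n) · (γ (suc n) * abel b (n ∸ n) 0#)
        ≡⟨ ≡.cong₂ (λ k l → k · ((c - l · b) ^ suc n * abel b l 0#)) (nCn≡1 (suc n)) (ℕ.n∸n≡0 n) ⟩
      (c - 0#) ^ suc n * 1# + 0#
        ≈⟨ trans (+-identityʳ _) (*-identityʳ _) ⟩
      (c - 0#) ^ suc n
        ≈⟨ ^-congˡ (suc n) (x-0≈x c) ⟩
      c ^ suc n ∎

  -- Closed forms of n! W

  -- The common induction step of the closed forms: a formula in one dimension less is integrated,
  -- and the new factor `suc n` of the factorial is the one in the derivative of `f`.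
  factorial*W : ∀ n xs {f} (g : Carrier → Carrier) → HasDerivative f (λ a → suc n · 1# * g a) → f 0# ≈ 0# →
    (∀ a → (n !) · W (addHead a xs) ≈ g a) → ∀ a → (suc n !) · W (a ∷ xs) ≈ f a
  factorial*W n xs {f} g f-derivative f0≈0 n!W≈g a = trans (·≈* (suc n !) _)
    (derivative-unique (derivative-scale ((suc n !) · 1#) (W-derivative xs)) f-derivative
      (λ a → begin
        (suc n !) · 1# * W (addHead a xs)              ≈⟨ *-congʳ (×1-homo-* (suc n) (n !)) ⟩
        suc n · 1# * (n !) · 1# * W (addHead a xs)     ≈⟨ *-assoc _ _ _ ⟩
        suc n · 1# * ((n !) · 1# * W (addHead a xs))   ≈⟨ *-congˡ (trans (sym (·≈* (n !) _)) (n!W≈g a)) ⟩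
        suc n · 1# * g a                               ∎)
      (trans (*-congˡ (W-0∷ xs)) (trans (zeroʳ _) (sym f0≈0))) a)

  W-constant : ∀ b k a → (suc k !) · W (a ∷ replicate k b) ≈ abel b (suc k) a
  W-constant b k = factorial*W k (replicate k b) (λ a → abel b k (a + b)) (abel-derivative b k) (abel-0 b k) (previous k)
    where
    previous : ∀ k a → (k !) · W (addHead a (replicate k b)) ≈ abel b k (a + b)
    previous zero    a = +-identityʳ 1#
    previous (suc k) a = W-constant b k (a + b)

  W-powers : ∀ k a → (suc k !) · W (a ∷ replicate k 0#) ≈ a ^ suc k
  W-powers k a = trans (W-constant 0# k a) (*-congˡ (^-congˡ k (trans
    (+-congˡ (trans (·≈* (suc k) 0#) (zeroʳ _))) (+-identityʳ a))))

  -- Induction on the number `p` of entries `b`, each of which is one integration. All terms vanish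
  -- at `a = 0#` because the truncation `suc m` stays below the dimension. Here `m` counts the
  -- trailing zeros, so `suc m` is the m of the third formula.
  W-one-change : ∀ b c m p a →
    (suc (p ℕ.+ suc m) !) · W (a ∷ replicate p b ++ c ∷ replicate m 0#)
      ≈ abelSum (λ j → (c - (suc (suc m) ∸ j) · b) ^ j) b (suc (p ℕ.+ suc m)) (suc m) a
  W-one-change b c m p = factorial*W (p ℕ.+ suc m) (replicate p b ++ c ∷ replicate m 0#)
    (λ a → abelSum γ b (p ℕ.+ suc m) (suc m) (a + b))
    (abelSum-derivative γ b (p ℕ.+ suc m) (suc m))
    (abelSum-0 γ b (s≤s (ℕ.m≤n+m (suc m) p)))
    (previous p)
    where
    γ : ℕ → Carrier
    γ j = (c - (suc (suc m) ∸ j) · b) ^ j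
    previous : ∀ p a →
      ((p ℕ.+ suc m) !) · W (addHead a (replicate p b ++ c ∷ replicate m 0#))
        ≈ abelSum γ b (p ℕ.+ suc m) (suc m) (a + b)
    previous zero    a = begin
      (suc m !) · W (a + c ∷ replicate m 0#)
        ≈⟨ W-powers m (a + c) ⟩
      (a + c) ^ suc m
        -- The target is evaluated at `a + b`, so `c` gives way to `c - b`; in this lowest dimension
        -- the truncated sum is the full sum of Abel's theorem.
        ≈⟨ ^-congˡ (suc m) ([a+b]+[c-b]≈a+c a b c) ⟨
      ((a + b) + (c - b)) ^ suc m
        ≈⟨ abel-binomial b (suc m) (c - b) (a + b) ⟨
      abelSum (λ j → ((c - b) - (suc m ∸ j) · b) ^ j) b (suc m) (suc m) (a + b)
        ≈⟨ abelSum-congᵞ b (suc m) (suc m) (a + b) (λ j≤m → sym (abel-shift c b (suc m) j≤m)) ⟩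
      abelSum γ b (suc m) (suc m) (a + b) ∎
    previous (suc p) a = W-one-change b c m p (a + b)

  -- As `m < n`, every degree `n ∸ j` is positive, so each Abel polynomial carries a factor `a` and
  -- the exceptional `abel b 0` does not occur.
  abelSum-factor : ∀ γ b {n m} a → m < n →
    abelSum γ b n m a
      ≈ a * sum {suc m} (λ i → let j = toℕ i in
          (n C j) · (γ j * (a + (n ∸ j) · b) ^ (n ∸ j ∸ 1)))
  abelSum-factor γ b {n} {m} a m<n = trans
    (sum-cong-< (suc m) (λ {j} j≤m → factor j (ℕ.<-≤-trans j≤m m<n)))
    (sym (*-distribˡ-sum {suc m} a (λ i → (n C toℕ i) · (γ (toℕ i) * rest (toℕ i)))))
    where
    rest : ℕ → Carrier
    rest j = (a + (n ∸ j) · b) ^ (n ∸ j ∸ 1)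
    abel≡ : ∀ {k} → 0 < k → abel b k a ≡ a * (a + k · b) ^ (k ∸ 1)
    abel≡ {suc k} _ = ≡.refl
    factor : ∀ j → j < n → abelTerm γ b n a j ≈ a * ((n C j) · (γ j * rest j))
    factor j j<n = begin
      (n C j) · (γ j * abel b (n ∸ j) a)       ≡⟨ ≡.cong (λ z → (n C j) · (γ j * z)) (abel≡ (ℕ.m<n⇒0<n∸m j<n)) ⟩
      (n C j) · (γ j * (a * rest j))           ≈⟨ ×-congʳ (n C j) (solve 3 (λ g a r → g :* (a :* r) := a :* (g :* r)) refl (γ j) a (rest j)) ⟩
      (n C j) · (a * (γ j * rest j))           ≈⟨ ×-comm-* (n C j) a (γ j * rest j) ⟨
      a * ((n C j) · (γ j * rest j))           ∎

-- The three formulas for a given family of volume polynomials.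

mainTheorem2 :
  ∀ {c ℓ₁ ℓ₂ ℓ₃} (ℝ : RealNumbers c ℓ₁ ℓ₂ ℓ₃) →
  let open RealNumbers ℝ
      open Volume ℝ in
  (V : ∀ n → Polynomial n) → (∀ n → IsVolumePolynomial (V n)) →
  (∀ n → 1 ℕ.≤ n →
    ∀ a b → 0# ≤ a → 0# ≤ b →
    ∀ (x : Point n) → toList x ≡ a ∷ replicate (n ∸ 1) b →
    (n !) · eval (V n) x ≈ a * (a + n · b) ^ (n ∸ 1))
  ×
  (∀ n → 3 ℕ.≤ n →
    ∀ a b c → 0# ≤ a → 0# ≤ b → 0# ≤ c →
    ∀ (x : Point n) → toList x ≡ a ∷ replicate (n ∸ 2) b ++ c ∷ [] →
    (n !) · eval (V n) x
      ≈ a * (a + n · b) ^ (n ∸ 1)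
        + (n · a) * (c - b) * (a + (n ∸ 1) · b) ^ (n ∸ 2))
  ×
  (∀ n m → 3 ℕ.≤ n → 1 ℕ.≤ m → m ℕ.≤ n ∸ 2 →
    ∀ a b c → 0# ≤ a → 0# ≤ b → 0# ≤ c →
    ∀ (x : Point n) →
    toList x ≡ a ∷ replicate (n ∸ m ∸ 1) b ++ c ∷ replicate (m ∸ 1) 0# →
    (n !) · eval (V n) x
      ≈ a * sum {suc m} (λ i → let j = toℕ i in
          (n C j) · ((c - (suc m ∸ j) · b) ^ j
                      * (a + (n ∸ j) · b) ^ (n ∸ j ∸ 1))))
mainTheorem2 ℝ V isVol = (λ where (suc n) _ a b _ _ → part₁ n a b) ,
  (λ n 3≤n a b c _ _ _ → part₂ n 3≤n a b c) ,
  (λ n m _ 1≤m m≤n∸2 a b c _ _ _ → part₃ n m 1≤m m≤n∸2 a b c)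
  where
  open BinomialCoefficients
  open RealNumbers ℝ
  open Volume ℝ
  open OrderedField ℝ using (·≈*)
  open VolumeFunction ℝ
  open VolumeOfΠ ℝ
  open ClosedForms ℝ
  open CommutativeRing commutativeRing using (commutativeSemiring)
  open import Algebra.Properties.Semiring.Mult semiring hiding (_×_)
  open import Algebra.Solver.Ring.NaturalCoefficients.Default commutativeSemiring
    using (solve; _:=_; _:+_; _:*_; con)
  open import Relation.Binary.Reasoning.Setoid setoid

  ·eval≈·W : ∀ k {n} (x : Point (suc n)) {xs} → toList x ≡ xs → k · eval (V (suc n)) x ≈ k · W xs
  ·eval≈·W k {n} x ≡.refl = ×-congʳ k (eval≈W (isVol (suc n)) x)

  part₁ : ∀ n a b (x : Point (suc n)) → toList x ≡ a ∷ replicate n b →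
    (suc n !) · eval (V (suc n)) x ≈ a * (a + suc n · b) ^ n
  part₁ n a b x x≡ = trans (·eval≈·W (suc n !) x x≡) (W-constant b n a)

  part₃ : ∀ n m → 1 ℕ.≤ m → m ℕ.≤ n ∸ 2 → ∀ a b c (x : Point n) →
    toList x ≡ a ∷ replicate (n ∸ m ∸ 1) b ++ c ∷ replicate (m ∸ 1) 0# →
    (n !) · eval (V n) x
      ≈ a * sum {suc m} (λ i → let j = toℕ i in
          (n C j) · ((c - (suc m ∸ j) · b) ^ j * (a + (n ∸ j) · b) ^ (n ∸ j ∸ 1)))
  part₃ (suc (suc k)) (suc m) _ 1+m≤k a b c x x≡ 
    with ℕ.m≤n⇒∃[o]m+o≡n 1+m≤k
  -- Now `k` is `suc m + o`, so there are `suc o` entries `b`, and the dimension is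
  -- `suc (suc o + suc m)`.
  ... | o , ≡.refl = trans (·eval≈·W (n !) x (≡.trans x≡ (≡.cong (λ q → a ∷ replicate q b ++ c ∷ replicate m 0#) p≡)))
    (trans (reflexive (≡.cong (λ q → (q !) · W (a ∷ replicate (suc o) b ++ c ∷ replicate m 0#)) n≡))
      (trans (W-one-change b c m (suc o) a)
        (trans (reflexive (≡.cong (λ q → abelSum (λ j → (c - (suc (suc m) ∸ j) · b) ^ j) b q (suc m) a) (≡.sym n≡)))
          (abelSum-factor (λ j → (c - (suc (suc m) ∸ j) · b) ^ j) b a
            (s≤s (s≤s (ℕ.m≤n⇒m≤1+n (ℕ.m≤m+n m o))))))))
    where
    n = suc (suc (suc m ℕ.+ o))
    n≡ : n ≡ suc (suc o ℕ.+ suc m)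
    n≡ = ≡.cong (λ q → suc (suc q)) (ℕ.+-comm (suc m) o)
    p≡ : n ∸ suc m ∸ 1 ≡ suc o
    p≡ = ≡.cong (_∸ 1) (≡.trans (≡.cong (_∸ suc m) n≡)
      (ℕ.m+n∸n≡m (suc (suc o)) (suc m)))

  part₂ : ∀ n → 3 ℕ.≤ n → ∀ a b c (x : Point n) →
    toList x ≡ a ∷ replicate (n ∸ 2) b ++ c ∷ [] →
    (n !) · eval (V n) x
      ≈ a * (a + n · b) ^ (n ∸ 1) + (n · a) * (c - b) * (a + (n ∸ 1) · b) ^ (n ∸ 2)
  part₂ n@(suc (suc (suc k))) (s≤s (s≤s (s≤s _))) a b c x x≡ = begin
    (n !) · eval (V n) x
      ≈⟨ part₃ n 1 (s≤s z≤n) (s≤s z≤n) a b c x x≡ ⟩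
    a * ((n C 0) · (1# * u) + ((n C 1) · ((c - 1 · b) ^ 1 * v) + 0#))
      ≡⟨ ≡.cong₂ (λ i j → a * (i · (1# * u) + (j · ((c - 1 · b) ^ 1 * v) + 0#))) (nC0≡1 n) (nC1≡n n) ⟩
    a * (1 · (1# * u) + (n · ((c - 1 · b) ^ 1 * v) + 0#))
      -- `1 · b` unfolds to `b + 0#`, hence the identity law under the negation.
      ≈⟨ *-congˡ (+-congˡ (+-congʳ (trans (·≈* n _)
           (*-congˡ (*-congʳ (*-congʳ (+-congˡ (-‿cong (+-identityʳ b))))))))) ⟩
    a * (1 · (1# * u) + (n · 1# * ((c - b) ^ 1 * v) + 0#))
      ≈⟨ solve 5 (λ a u v d n → a :* ((con 1 :* u :+ con 0) :+ (n :* (d :* con 1 :* v) :+ con 0))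
                             := a :* u :+ n :* a :* d :* v) refl a u v (c - b) (n · 1#) ⟩
    a * u + n · 1# * a * (c - b) * v
      ≈⟨ +-congˡ (*-congʳ (*-congʳ (·≈* n a))) ⟨
    a * u + (n · a) * (c - b) * v ∎
    where
    u = (a + n · b) ^ (n ∸ 1)
    v = (a + (n ∸ 1) · b) ^ (n ∸ 2)
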